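{- If $G$ is a connected cograph and $v$ is a vertex of $G$, then $M_{G,v}\geq M_G$, with equality if and only if $G\cong K_1$.
   Context: All graphs are finite and simple with at least one vertex. A graph is a cograph if it contains no induced path on $4$ vertices. For a graph $G$ of order $n$ (number of vertices), let $a_k(G)$ be the number of $k$-element vertex subsets of $G$ that induce a connected subgraph (single vertices count as connected), and for a vertex $v$ let $a_k(G;v)$ be the number of those containing $v$. Let $\Phi_G(x)=\sum_{k=1}^n a_k(G)x^k$ and $\Phi_{G,v}(x)=\sum_{k=1}^n a_k(G;v)x^k$. The global mean is $M_G=\Phi_G'(1)/\Phi_G(1)$, and the local mean at $v$ is $M_{G,v}=\Phi_{G,v}'(1)/\Phi_{G,v}(1)$. -}

module Defs where

open import Data.Fin.Base using (Fin; toℕ)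
import Data.Fin.Properties as Fin
open import Data.Fin.Subset using (Subset; inside; outside; _∈_; ∣_∣; ⁅_⁆; _-_)
open import Data.Fin.Subset.Properties
  using (_∈?_; nonempty?; x∈⁅x⁆; x∈⁅y⁆⇒x≡y; ∣⁅x⁆∣≡1; x∈p∧x≢y⇒x∈p-y; x∈p⇒∣p-x∣<∣p∣; p─q⊆p)
open import Data.Integer.Base using (+_)
open import Data.List.Base
  using (List; []; _∷_; _++_; map; filter; length; drop; zipWith; upTo; applyUpTo)
import Data.List.Membership.Propositional as List
open import Data.List.Membership.Propositional.Properties
  using (∈-map⁺; ∈-++⁺ˡ; ∈-++⁺ʳ; ∈-filter⁺)
open import Data.List.Relation.Unary.Any using (here)
open import Data.Nat.Base using (ℕ; zero; suc; _+_; _*_; _<_; NonZero; >-nonZero)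
open import Data.Nat.Induction using (<-wellFounded)
import Data.Nat.Properties as ℕ
open import Data.Product.Base using (∃; _×_; _,_; proj₁; proj₂)
open import Data.Rational.Base using (ℚ; _/_)
open import Data.Sum.Base using (_⊎_; inj₁; inj₂; swap)
open import Data.Vec.Base using ([]; _∷_)
open import Data.Vec.Properties.WithK using ([]=-irrelevant)
open import Function.Base using (_on_)
open import Function.Bundles using (_↔_; _⇔_; Inverse)
open import Induction.WellFounded using (Acc; acc)
open import Level using (0ℓ)
open import Relation.Binary.Construct.Closure.ReflexiveTransitive using (Star; ε; _◅_)
open import Relation.Binary.Core using (Rel)
open import Relation.Binary.Definitions using (Decidable; Symmetric; Irreflexive)
open import Relation.Binary.PropositionalEquality
  using (_≡_; _≢_; refl; sym; cong; ≢-sym)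
open import Relation.Nullary using (Dec; yes; no; ¬_; ¬?; contradiction)
open import Relation.Nullary.Decidable using (map′; _×-dec_; _⊎-dec_; _→-dec_)

-- Finite graphs of order n are represented on the vertex set Fin n; a
-- general vertex type is allowed so that induced subgraphs are graphs.

record Graph (V : Set) : Set₁ where
  infix 4 _∼_ _∼?_
  field
    _∼_    : Rel V 0ℓ
    _∼?_   : Decidable _∼_
    ∼-sym  : Symmetric _∼_
    ∼-irr  : Irreflexive _≡_ _∼_

infix 4 _≅_

record _≅_ {V W : Set} (G : Graph V) (H : Graph W) : Set where
  private
    module G = Graph G
    module H = Graph H
  field
    bijection : V ↔ W
  open Inverse bijection public using (to; from)
  field
    adjacency : ∀ u w → u G.∼ w ⇔ to u H.∼ to w

-- The factor V asserts that there is at least one vertex.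
Connected : {V : Set} → Graph V → Set
Connected {V} G = V × (∀ u w → Star (Graph._∼_ G) u w)

induced : ∀ {n} → Graph (Fin n) → (S : Subset n) → Graph (∃ (_∈ S))
induced G S = record
  { _∼_   = _∼_ on proj₁
  ; _∼?_  = λ u w → proj₁ u ∼? proj₁ w
  ; ∼-sym = ∼-sym
  ; ∼-irr = λ u≡w → ∼-irr (cong proj₁ u≡w)
  }
  where open Graph G

K : (n : ℕ) → Graph (Fin n)
K n = record
  { _∼_   = _≢_
  ; _∼?_  = λ i j → ¬? (i Fin.≟ j)
  ; ∼-sym = ≢-sym
  ; ∼-irr = λ i≡j i≢j → i≢j i≡j
  }

P : (n : ℕ) → Graph (Fin n)
P n = record
  { _∼_   = λ i j → toℕ j ≡ suc (toℕ i) ⊎ toℕ i ≡ suc (toℕ j)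
  ; _∼?_  = λ i j → (toℕ j ℕ.≟ suc (toℕ i)) ⊎-dec (toℕ i ℕ.≟ suc (toℕ j))
  ; ∼-sym = swap
  ; ∼-irr = λ { refl (inj₁ e) → ℕ.1+n≢n (sym e)
              ; refl (inj₂ e) → ℕ.1+n≢n (sym e) }
  }

Cograph : ∀ {n} → Graph (Fin n) → Set
Cograph G = ∀ S → ¬ (induced G S ≅ P 4)

module _ {n : ℕ} (G : Graph (Fin n)) where
  open Graph G

  private
    -- Decidability of connectedness is by recursion on ∣ S ∣: a walk from x
    -- inside S is cut at its last visit to x, leaving a walk inside S - x.
    Step : Subset n → Rel (Fin n) 0ℓ
    Step S a b = a ∼ b × b ∈ S

    Exit : Subset n → Rel (Fin n) 0ℓ
    Exit S x y = ∃ λ z → (x ∼ z) × (z ∈ S - x) × Star (Step (S - x)) z y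

    lastExit : ∀ {S u y} x → Star (Step S) u y →
               Star (Step (S - x)) u y ⊎ (x ≡ y ⊎ Exit S x y)
    lastExit x ε = inj₁ ε
    lastExit x (_◅_ {j = b} (u∼b , b∈S) w) with lastExit x w
    ... | inj₂ r = inj₂ r
    ... | inj₁ w′ with b Fin.≟ x
    ...   | no b≢x = inj₁ ((u∼b , x∈p∧x≢y⇒x∈p-y b∈S b≢x) ◅ w′)
    ...   | yes refl with w′
    ...     | ε = inj₂ (inj₁ refl)
    ...     | (x∼z , z∈S-x) ◅ w″ = inj₂ (inj₂ (_ , x∼z , z∈S-x , w″))

    fromStart : ∀ {S x y} → Star (Step S) x y → x ≡ y ⊎ Exit S x y
    fromStart {x = x} w with lastExit x w
    ... | inj₂ r = r
    ... | inj₁ ε = inj₁ refl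
    ... | inj₁ ((x∼z , z∈S-x) ◅ w′) = inj₂ (_ , x∼z , z∈S-x , w′)

    weaken : ∀ {S x a b} → Star (Step (S - x)) a b → Star (Step S) a b
    weaken ε = ε
    weaken {S} {x} ((a∼b , b∈) ◅ w) = (a∼b , p─q⊆p S ⁅ x ⁆ b∈) ◅ weaken w

    toWalk : ∀ {S x y} → x ≡ y ⊎ Exit S x y → Star (Step S) x y
    toWalk (inj₁ refl) = ε
    toWalk {S} {x} (inj₂ (z , x∼z , z∈ , w)) = (x∼z , p─q⊆p S ⁅ x ⁆ z∈) ◅ weaken w

    walk? : ∀ S → Acc _<_ ∣ S ∣ → ∀ x y → x ∈ S → Dec (Star (Step S) x y)
    walk? S (acc rs) x y x∈S = map′ toWalk fromStart
      ((x Fin.≟ y) ⊎-dec Fin.any? λ z → exit? z)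
      where
      exit? : ∀ z → Dec ((x ∼ z) × (z ∈ S - x) × Star (Step (S - x)) z y)
      exit? z with x ∼? z | z ∈? (S - x)
      ... | no ¬p | _ = no λ p → ¬p (proj₁ p)
      ... | yes _ | no ¬p = no λ p → ¬p (proj₁ (proj₂ p))
      ... | yes p | yes q = map′ (λ w → p , q , w) (λ e → proj₂ (proj₂ e))
              (walk? (S - x) (rs (x∈p⇒∣p-x∣<∣p∣ x∈S)) z y q)

    Joined : Subset n → Rel (Fin n) 0ℓ
    Joined S u w = u ∈ S → w ∈ S → Star (Step S) u w

    joined? : ∀ S u w → Dec (Joined S u w)
    joined? S u w with u ∈? S
    ... | no u∉S  = yes λ u∈S → contradiction u∈S u∉S
    ... | yes u∈S = map′ (λ f _ → f) (λ f → f u∈S)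
                      ((w ∈? S) →-dec walk? S (<-wellFounded ∣ S ∣) u w u∈S)

    lift : ∀ {S u w} → Star (Step S) u w → (p : u ∈ S) (q : w ∈ S) →
           Star (Graph._∼_ (induced G S)) (u , p) (w , q)
    lift ε p q with refl ← []=-irrelevant p q = ε
    lift ((a∼b , b∈S) ◅ w) p q = a∼b ◅ lift w b∈S q

    lower : ∀ {S u w} → Star (Graph._∼_ (induced G S)) u w →
            Star (Step S) (proj₁ u) (proj₁ w)
    lower ε = ε
    lower (_◅_ {j = b} a∼b w) = (a∼b , proj₂ b) ◅ lower w

  inducedConnected? : ∀ S → Dec (Connected (induced G S))
  inducedConnected? S = nonempty? S ×-dec map′
    (λ f u w → lift (f (proj₁ u) (proj₁ w) (proj₂ u) (proj₂ w)) (proj₂ u) (proj₂ w))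
    (λ f u w p q → lower (f (u , p) (w , q)))
    (Fin.all? λ u → Fin.all? λ w → joined? S u w)

-- Coefficients are listed with the constant term first.
Poly : Set
Poly = List ℕ

eval : Poly → ℕ → ℕ
eval []      x = 0
eval (c ∷ p) x = c + x * eval p x

-- Multiply each coefficient by its degree, then shift down by one.
deriv : Poly → Poly
deriv p = drop 1 (zipWith _*_ (upTo (length p)) p)

-- Every subset of Fin n, listed exactly once.
subsets : ∀ n → List (Subset n)
subsets zero    = [] ∷ []
subsets (suc n) = map (outside ∷_) (subsets n) ++ map (inside ∷_) (subsets n)

module _ {n : ℕ} (G : Graph (Fin n)) where

  a : ℕ → ℕ
  a k = length (filter (λ S → (∣ S ∣ ℕ.≟ k) ×-dec inducedConnected? G S) (subsets n))

  aAt : Fin n → ℕ → ℕ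
  aAt v k = length (filter
    (λ S → (∣ S ∣ ℕ.≟ k) ×-dec inducedConnected? G S ×-dec (v ∈? S)) (subsets n))

  -- The sums run over 1 ≤ k ≤ n, so the constant terms are 0.
  Φ : Poly
  Φ = 0 ∷ applyUpTo (λ i → a (suc i)) n

  ΦAt : Fin n → Poly
  ΦAt v = 0 ∷ applyUpTo (λ i → aAt v (suc i)) n

-- Φ and ΦAt do not vanish at 1: a singleton induces a connected subgraph.
private
  ∈-subsets : ∀ {n} (S : Subset n) → S List.∈ subsets n
  ∈-subsets []            = here refl
  ∈-subsets (outside ∷ S) = ∈-++⁺ˡ (∈-map⁺ _ (∈-subsets S))
  ∈-subsets {suc n} (inside ∷ S) =
    ∈-++⁺ʳ (map (outside ∷_) (subsets n)) (∈-map⁺ _ (∈-subsets S))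

  length>0 : ∀ {A : Set} {x : A} {xs} → x List.∈ xs → 0 < length xs
  length>0 {xs = _ ∷ _} _ = ℕ.0<1+n

  eval>0 : ∀ m (f : ℕ → ℕ) → 0 < f 0 → NonZero (eval (0 ∷ applyUpTo f (suc m)) 1)
  eval>0 m f 0<f0 =
    >-nonZero (ℕ.<-≤-trans 0<f0 (ℕ.≤-trans (ℕ.m≤m+n _ _) (ℕ.m≤m+n _ 0)))

  ⁅⁆-connected : ∀ {n} (G : Graph (Fin n)) v → Connected (induced G ⁅ v ⁆)
  ⁅⁆-connected G v = (v , x∈⁅x⁆ v) , joined
    where
    joined : ∀ u w → Star (Graph._∼_ (induced G ⁅ v ⁆)) u w
    joined (u , p) (w , q) with refl ← x∈⁅y⁆⇒x≡y v p | refl ← x∈⁅y⁆⇒x≡y v q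
      with refl ← []=-irrelevant p q = ε

Φ-nonZero : ∀ {n} .{{_ : NonZero n}} (G : Graph (Fin n)) → NonZero (eval (Φ G) 1)
Φ-nonZero {suc n} G = eval>0 n (λ i → a G (suc i)) (length>0
  (∈-filter⁺ _ (∈-subsets ⁅ v ⁆) (∣⁅x⁆∣≡1 v , ⁅⁆-connected G v)))
  where v = Fin.zero

ΦAt-nonZero : ∀ {n} (G : Graph (Fin n)) v → NonZero (eval (ΦAt G v) 1)
ΦAt-nonZero {suc n} G v = eval>0 n (λ i → aAt G v (suc i)) (length>0
  (∈-filter⁺ _ (∈-subsets ⁅ v ⁆) (∣⁅x⁆∣≡1 v , ⁅⁆-connected G v , x∈⁅x⁆ v)))

globalMean : ∀ {n} .{{_ : NonZero n}} → Graph (Fin n) → ℚ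
globalMean G = (+ eval (deriv (Φ G)) 1 / eval (Φ G) 1) {{Φ-nonZero G}}

localMean : ∀ {n} → Graph (Fin n) → Fin n → ℚ
localMean G v = (+ eval (deriv (ΦAt G v)) 1 / eval (ΦAt G v) 1) {{ΦAt-nonZero G v}}

{-# OPTIONS --safe #-}
module Submission where

-- Let v be a vertex of a connected cograph G of order n. The connected sets containing v have
-- average size at least (n + 1) / 2, whereas those avoiding v have average size at most n / 2;
-- the latter exist unless n = 1. Both bounds follow by induction along a cotree. When T is the
-- disjoint union of T₁ and T₂, the subsets of T meeting both parts are all connected (join) or
-- all disconnected (union), so every sum over the connected, or the disconnected, subsets of T
-- is a closed form in ∣ T₁ ∣ and ∣ T₂ ∣ plus the corresponding sums over T₁ and T₂. For the
-- first bound it is convenient to sum over the disconnected sets containing v: in a join they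
-- lie in the part of v.

open import Defs
open import Data.Bool.Base using (Bool; true; false; not; if_then_else_; _∧_)
open import Data.Bool.Properties using (¬-not; not-¬; not-involutive; ∧-identityʳ; ∧-zeroʳ)
  renaming (_≟_ to _≟ᵇ_)
open import Data.Empty using () renaming (⊥ to Absurd; ⊥-elim to absurd)
open import Data.Fin.Base using (Fin; zero; suc)
open import Data.Fin.Patterns using (0F; 1F; 2F; 3F)
open import Data.Fin.Properties using (_≟_; any?; all?)
open import Data.Fin.Subset
  using (Subset; inside; outside; _∈_; _∉_; _⊆_; _⊂_; ⊥; ⊤; _∪_; _∩_; ∣_∣; Nonempty; Empty; ⁅_⁆)
  renaming (_-_ to _∖_)
open import Data.Fin.Subset.Properties
open import Data.Integer.Base as ℤ
  using (ℤ; +_; -_; _+_; _-_; _*_; _≤_; 0ℤ; 1ℤ; +≤+; nonNegative)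
import Data.Integer.Properties as ℤ
open import Data.Integer.Tactic.RingSolver using (solve-∀)
open import Data.List.Base using (List; []; _∷_; _++_; map; length; filter; applyUpTo; zipWith)
open import Data.List.Properties using (map-∘; map-++; length-applyUpTo)
open import Data.Nat.Base as ℕ using (ℕ; zero; suc; z≤n; s≤s; _<_; _^_; pred; _≡ᵇ_; NonZero)
open import Data.Nat.Induction using (<-wellFounded)
open import Data.Nat.ListAction using (sum)
open import Data.Nat.ListAction.Properties using (sum-++)
import Data.Nat.Properties as ℕ
import Data.Nat.Tactic.RingSolver as ℕ-Solver
open import Data.Product.Base using (_×_; _,_; proj₁; proj₂; ∃)
open import Data.Rational.Base as ℚ using (_≥_; _/_)
import Data.Rational.Properties as ℚ
open import Data.Rational.Unnormalised.Base using (mkℚᵘ; *<*)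
import Data.Rational.Unnormalised.Properties as ℚᵘ
open import Data.Sum.Base using (_⊎_; inj₁; inj₂; [_,_]′)
open import Data.Vec.Base using ([]; _∷_; here; there; tabulate; lookup)
open import Data.Vec.Properties using (lookup⇒[]=; []=⇒lookup; lookup∘tabulate)
open import Data.Vec.Properties.WithK using ([]=-irrelevant)
open import Function.Base using (_∘_)
open import Function.Bundles using (_⇔_; mk⇔; mk↔ₛ′; Inverse)
open import Induction.WellFounded using (Acc; acc)
open import Relation.Binary.Construct.Closure.ReflexiveTransitive using (Star; ε; _◅_; gmap)
open import Relation.Binary.PropositionalEquality
open import Relation.Nullary using (Dec; yes; no; does; contradiction; ¬_; ¬?)
open import Relation.Nullary.Decidable
  using (dec-true; dec-false; _×-dec_; _→-dec_; from-yes; does-⇔)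
open import Relation.Unary using (Decidable)

-- The induction cannot stay within connected graphs: deleting v, or passing to the part of v in a
-- join, may leave a disconnected T. The upper bound (∣ T ∣ + 1) / 2 for all connected subsets
-- survives in every cotree, and ∣ T ∣ = n - 1 turns it into n / 2. The bound (∣ T ∣ + 1) / 2 for
-- the disconnected sets containing v does not survive: in a disjoint union of two single vertices
-- the only such set has size 2. The induction therefore carries (∣ T ∣ + 2) / 2, and the lost 1/2
-- is regained at the root, a join, where the part of v misses at least one vertex. An average is
-- encoded by the sign of an integer sum of terms c + 2 ∣ S ∣, so that no division occurs before the
-- means themselves are compared.

private variable
  n : ℕ

-- Sums over the subsets of a finite set

𝟙 : Bool → ℤ
𝟙 true  = 1ℤ
𝟙 false = 0ℤ

Σ⊆ : Subset n → (Subset n → ℤ) → ℤ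
Σ⊆ []            f = f []
Σ⊆ (outside ∷ T) f = Σ⊆ T (f ∘ (outside ∷_))
Σ⊆ (inside  ∷ T) f = Σ⊆ T (f ∘ (outside ∷_)) + Σ⊆ T (f ∘ (inside ∷_))

Σ-cong : ∀ (T : Subset n) {f g} → (∀ S → S ⊆ T → f S ≡ g S) → Σ⊆ T f ≡ Σ⊆ T g
Σ-cong []            f≡g = f≡g [] λ ()
Σ-cong (outside ∷ T) f≡g = Σ-cong T λ S S⊆T → f≡g _ (out⊆ S⊆T)
Σ-cong (inside  ∷ T) f≡g = cong₂ _+_
  (Σ-cong T λ S S⊆T → f≡g _ (out⊆ S⊆T)) (Σ-cong T λ S S⊆T → f≡g _ (in⊆in S⊆T))

Σ-mono : ∀ (T : Subset n) {f g} → (∀ S → S ⊆ T → f S ≤ g S) → Σ⊆ T f ≤ Σ⊆ T g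
Σ-mono []            f≤g = f≤g [] λ ()
Σ-mono (outside ∷ T) f≤g = Σ-mono T λ S S⊆T → f≤g _ (out⊆ S⊆T)
Σ-mono (inside  ∷ T) f≤g = ℤ.+-mono-≤
  (Σ-mono T λ S S⊆T → f≤g _ (out⊆ S⊆T)) (Σ-mono T λ S S⊆T → f≤g _ (in⊆in S⊆T))

interchange : ∀ a b c d → (a + b) + (c + d) ≡ (a + c) + (b + d)
interchange = solve-∀

Σ-+ : ∀ (T : Subset n) f g → Σ⊆ T (λ S → f S + g S) ≡ Σ⊆ T f + Σ⊆ T g
Σ-+ []            f g = refl
Σ-+ (outside ∷ T) f g = Σ-+ T _ _
Σ-+ (inside  ∷ T) f g = trans (cong₂ _+_ (Σ-+ T _ _) (Σ-+ T _ _))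
  (interchange (Σ⊆ T _) (Σ⊆ T _) (Σ⊆ T _) (Σ⊆ T _))

Σ-*ˡ : ∀ (T : Subset n) c f → Σ⊆ T (λ S → c * f S) ≡ c * Σ⊆ T f
Σ-*ˡ []            c f = refl
Σ-*ˡ (outside ∷ T) c f = Σ-*ˡ T c _
Σ-*ˡ (inside  ∷ T) c f = trans (cong₂ _+_ (Σ-*ˡ T c _) (Σ-*ˡ T c _))
  (sym (ℤ.*-distribˡ-+ c (Σ⊆ T _) (Σ⊆ T _)))

Σ-0 : ∀ (T : Subset n) → Σ⊆ T (λ _ → 0ℤ) ≡ 0ℤ
Σ-0 T = Σ-*ˡ T 0ℤ λ _ → 0ℤ

Σ-nonneg : ∀ (T : Subset n) {f} → (∀ S → S ⊆ T → 0ℤ ≤ f S) → 0ℤ ≤ Σ⊆ T f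
Σ-nonneg T {f} 0≤f = subst (_≤ Σ⊆ T f) (Σ-0 T) (Σ-mono T 0≤f)

-- Only the empty set can distinguish f from g.
Σ-agree : ∀ (T : Subset n) {f g} → (∀ S → S ⊆ T → Nonempty S → f S ≡ g S) →
          Σ⊆ T f ≡ Σ⊆ T g + (f ⊥ - g ⊥)
Σ-agree [] {f} {g} f≡g = lem (f []) (g [])
  where
  lem : ∀ x y → x ≡ y + (x - y)
  lem = solve-∀
Σ-agree (outside ∷ T) f≡g =
  Σ-agree T λ { S S⊆T (x , x∈S) → f≡g _ (out⊆ S⊆T) (suc x , there x∈S) }
Σ-agree (inside ∷ T) {f} {g} f≡g = trans
  (cong₂ _+_ (Σ-agree T λ { S S⊆T (x , x∈S) → f≡g _ (out⊆ S⊆T) (suc x , there x∈S) })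
             (Σ-cong T λ S S⊆T → f≡g _ (in⊆in S⊆T) (zero , here)))
  (lem (Σ⊆ T (g ∘ (outside ∷_))) (Σ⊆ T (g ∘ (inside ∷_))) _)
  where
  lem : ∀ a b d → (a + d) + b ≡ (a + b) + d
  lem = solve-∀

Disjoint : Subset n → Subset n → Set
Disjoint T₁ T₂ = ∀ {x} → x ∈ T₁ → x ∉ T₂

Disjoint-drop : ∀ {s t} {T₁ T₂ : Subset n} → Disjoint (s ∷ T₁) (t ∷ T₂) → Disjoint T₁ T₂
Disjoint-drop d x∈T₁ x∈T₂ = d (there x∈T₁) (there x∈T₂)

-- By disjointness a subset of the union splits uniquely as `S₁ ∪ S₂`; each vertex offers a choice
-- in at most one of the two sums.
Σ-∪ : ∀ (T₁ T₂ : Subset n) f → Disjoint T₁ T₂ →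
      Σ⊆ (T₁ ∪ T₂) f ≡ Σ⊆ T₁ λ S₁ → Σ⊆ T₂ λ S₂ → f (S₁ ∪ S₂)
Σ-∪ []             []             f d = refl
Σ-∪ (outside ∷ T₁) (outside ∷ T₂) f d = Σ-∪ T₁ T₂ _ (Disjoint-drop d)
Σ-∪ (outside ∷ T₁) (inside  ∷ T₂) f d = trans
  (cong₂ _+_ (Σ-∪ T₁ T₂ _ (Disjoint-drop d)) (Σ-∪ T₁ T₂ _ (Disjoint-drop d)))
  (sym (Σ-+ T₁ _ _))
Σ-∪ (inside  ∷ T₁) (outside ∷ T₂) f d =
  cong₂ _+_ (Σ-∪ T₁ T₂ _ (Disjoint-drop d)) (Σ-∪ T₁ T₂ _ (Disjoint-drop d))
Σ-∪ (inside  ∷ T₁) (inside  ∷ T₂) f d = contradiction here (d here)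

∣∪∣ : ∀ (T₁ T₂ : Subset n) → Disjoint T₁ T₂ → + ∣ T₁ ∪ T₂ ∣ ≡ + ∣ T₁ ∣ + + ∣ T₂ ∣
∣∪∣ T₁ T₂ d = cong +_ (go T₁ T₂ d)
  where
  go : ∀ {n} (T₁ T₂ : Subset n) → Disjoint T₁ T₂ → ∣ T₁ ∪ T₂ ∣ ≡ ∣ T₁ ∣ ℕ.+ ∣ T₂ ∣
  go []             []             d = refl
  go (outside ∷ T₁) (outside ∷ T₂) d = go T₁ T₂ (Disjoint-drop d)
  go (outside ∷ T₁) (inside  ∷ T₂) d =
    trans (cong suc (go T₁ T₂ (Disjoint-drop d))) (sym (ℕ.+-suc ∣ T₁ ∣ ∣ T₂ ∣))
  go (inside  ∷ T₁) (outside ∷ T₂) d = cong suc (go T₁ T₂ (Disjoint-drop d))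
  go (inside  ∷ T₁) (inside  ∷ T₂) d = contradiction here (d here)

2^∣_∣ : Subset n → ℤ
2^∣ T ∣ = + (2 ^ ∣ T ∣)

2^∣in∣ : ∀ (T : Subset n) → 2^∣ inside ∷ T ∣ ≡ + 2 * 2^∣ T ∣
2^∣in∣ T = ℤ.pos-* 2 (2 ^ ∣ T ∣)

-- The only estimate that plays exponential terms against linear ones; both bounds rest on it when
-- the mixed sets of a node are weighed.
1+∣T∣≤2^∣T∣ : ∀ (T : Subset n) → 1ℤ + + ∣ T ∣ ≤ 2^∣ T ∣
1+∣T∣≤2^∣T∣ T = +≤+ (go ∣ T ∣)
  where
  go : ∀ k → suc k ℕ.≤ 2 ^ k
  go zero    = s≤s z≤n
  go (suc k) = subst (suc (suc k) ℕ.≤_) (cong (2 ^ k ℕ.+_) (sym (ℕ.+-identityʳ (2 ^ k))))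
    (ℕ.+-mono-≤ (ℕ.≤-trans (s≤s z≤n) (go k)) (go k))

-- Complementation pairs sizes k and ∣ T ∣ - k, so the mean of c + 2 ∣ S ∣ is c + ∣ T ∣. The factor
-- 2 keeps this integral.
Σ-affine : ∀ (T : Subset n) c → Σ⊆ T (λ S → c + + 2 * + ∣ S ∣) ≡ 2^∣ T ∣ * (c + + ∣ T ∣)
Σ-affine [] c = lem c
  where
  lem : ∀ c → c + + 2 * 0ℤ ≡ 1ℤ * (c + 0ℤ)
  lem = solve-∀
Σ-affine (outside ∷ T) c = Σ-affine T c
Σ-affine (inside  ∷ T) c = begin
  Σ⊆ T (λ S → c + + 2 * + ∣ S ∣) + Σ⊆ T (λ S → c + + 2 * (1ℤ + + ∣ S ∣))
    ≡⟨ cong₂ _+_ (Σ-affine T c)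
         (trans (Σ-cong T λ S _ → shift c (+ ∣ S ∣)) (Σ-affine T (c + + 2))) ⟩
  2^∣ T ∣ * (c + + ∣ T ∣) + 2^∣ T ∣ * (c + + 2 + + ∣ T ∣)
    ≡⟨ lem 2^∣ T ∣ c (+ ∣ T ∣) ⟩
  (+ 2 * 2^∣ T ∣) * (c + (1ℤ + + ∣ T ∣))
    ≡⟨ cong (_* (c + (1ℤ + + ∣ T ∣))) (2^∣in∣ T) ⟨
  2^∣ inside ∷ T ∣ * (c + (1ℤ + + ∣ T ∣)) ∎
  where
  open ≡-Reasoning
  shift : ∀ c s → c + + 2 * (1ℤ + s) ≡ c + + 2 + + 2 * s
  shift = solve-∀
  lem : ∀ x c t → x * (c + t) + x * (c + + 2 + t) ≡ (+ 2 * x) * (c + (1ℤ + t))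
  lem = solve-∀

Σ-one : ∀ (T : Subset n) → Σ⊆ T (λ _ → 1ℤ) ≡ 2^∣ T ∣
Σ-one []            = refl
Σ-one (outside ∷ T) = Σ-one T
Σ-one (inside  ∷ T) = trans (cong₂ _+_ (Σ-one T) (Σ-one T))
  (trans (lem 2^∣ T ∣) (sym (2^∣in∣ T)))
  where
  lem : ∀ x → x + x ≡ + 2 * x
  lem = solve-∀

ι : Fin n → Subset n → ℤ
ι v S = 𝟙 (does (v ∈? S))

-- Removing v reduces this to the subsets of a set with one element fewer; v itself accounts for the
-- additional 1. The number of sets is left as `Σ⊆ T (ι v)`, because later only its sign matters.
Σ-ι-affine : ∀ {T : Subset n} {v} → v ∈ T → ∀ c →
  Σ⊆ T (λ S → ι v S * (c + + 2 * + ∣ S ∣)) ≡ Σ⊆ T (ι v) * (c + + ∣ T ∣ + 1ℤ)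
Σ-ι-affine {T = inside ∷ T} here c = begin
  Σ⊆ T (λ S → 0ℤ * (c + + 2 * + ∣ S ∣)) + Σ⊆ T (λ S → 1ℤ * (c + + 2 * (1ℤ + + ∣ S ∣)))
    ≡⟨ cong₂ _+_
         (trans (Σ-*ˡ T 0ℤ λ S → c + + 2 * + ∣ S ∣) (ℤ.*-zeroˡ (Σ⊆ T λ S → c + + 2 * + ∣ S ∣)))
         (trans (Σ-cong T λ S _ → shift c (+ ∣ S ∣)) (Σ-affine T (c + + 2))) ⟩
  0ℤ + 2^∣ T ∣ * (c + + 2 + + ∣ T ∣)
    ≡⟨ lem 2^∣ T ∣ c (+ ∣ T ∣) ⟩
  (0ℤ + 2^∣ T ∣) * (c + (1ℤ + + ∣ T ∣) + 1ℤ)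
    ≡⟨ cong₂ (λ x y → (x + y) * (c + (1ℤ + + ∣ T ∣) + 1ℤ)) (Σ-0 T) (Σ-one T) ⟨
  (Σ⊆ T (λ _ → 0ℤ) + Σ⊆ T (λ _ → 1ℤ)) * (c + (1ℤ + + ∣ T ∣) + 1ℤ) ∎
  where
  open ≡-Reasoning
  shift : ∀ c s → 1ℤ * (c + + 2 * (1ℤ + s)) ≡ c + + 2 + + 2 * s
  shift = solve-∀
  lem : ∀ x c t → 0ℤ + x * (c + + 2 + t) ≡ (0ℤ + x) * (c + (1ℤ + t) + 1ℤ)
  lem = solve-∀
Σ-ι-affine {T = outside ∷ T} (there v∈T) c = Σ-ι-affine v∈T c
Σ-ι-affine {T = inside ∷ T} {suc v} (there v∈T) c = begin
  Σ⊆ T (λ S → ι v S * (c + + 2 * + ∣ S ∣)) + Σ⊆ T (λ S → ι v S * (c + + 2 * (1ℤ + + ∣ S ∣)))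
    ≡⟨ cong₂ _+_ (Σ-ι-affine v∈T c)
         (trans (Σ-cong T λ S _ → cong (ι v S *_) (shift c (+ ∣ S ∣)))
                (Σ-ι-affine v∈T (c + + 2))) ⟩
  Σ⊆ T (ι v) * (c + + ∣ T ∣ + 1ℤ) + Σ⊆ T (ι v) * (c + + 2 + + ∣ T ∣ + 1ℤ)
    ≡⟨ lem (Σ⊆ T (ι v)) c (+ ∣ T ∣) ⟩
  (Σ⊆ T (ι v) + Σ⊆ T (ι v)) * (c + (1ℤ + + ∣ T ∣) + 1ℤ) ∎
  where
  open ≡-Reasoning
  shift : ∀ c s → c + + 2 * (1ℤ + s) ≡ c + + 2 + + 2 * s
  shift = solve-∀
  lem : ∀ x c t → x * (c + t + 1ℤ) + x * (c + + 2 + t + 1ℤ) ≡ (x + x) * (c + (1ℤ + t) + 1ℤ)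
  lem = solve-∀

Σ-⊥ : ∀ n (f : Subset n → ℤ) → Σ⊆ ⊥ f ≡ f ⊥
Σ-⊥ zero    f = refl
Σ-⊥ (suc n) f = Σ-⊥ n _

Σ-⁅⁆ : ∀ (v : Fin n) f → Σ⊆ ⁅ v ⁆ f ≡ f ⊥ + f ⁅ v ⁆
Σ-⁅⁆ zero    f = cong₂ _+_ (Σ-⊥ _ (f ∘ (outside ∷_))) (Σ-⊥ _ (f ∘ (inside ∷_)))
Σ-⁅⁆ (suc v) f = Σ-⁅⁆ v _

-- By inclusion–exclusion, F and G differ only through the pairs with an empty component.
Σ-agree₂ : ∀ (T₁ T₂ : Subset n) (F G : Subset n → Subset n → ℤ) →
  (∀ S₁ S₂ → S₁ ⊆ T₁ → S₂ ⊆ T₂ → Nonempty S₁ → Nonempty S₂ → F S₁ S₂ ≡ G S₁ S₂) →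
  Σ⊆ T₁ (λ S₁ → Σ⊆ T₂ (F S₁)) ≡
    Σ⊆ T₁ (λ S₁ → Σ⊆ T₂ (G S₁))
      + ((Σ⊆ T₁ (λ S₁ → F S₁ ⊥) + Σ⊆ T₂ (F ⊥) - F ⊥ ⊥)
         - (Σ⊆ T₁ (λ S₁ → G S₁ ⊥) + Σ⊆ T₂ (G ⊥) - G ⊥ ⊥))
Σ-agree₂ T₁ T₂ F G F≡G = begin
  Σ⊆ T₁ (λ S₁ → Σ⊆ T₂ (F S₁))
    ≡⟨ Σ-agree T₁ (λ S₁ S₁⊆T₁ ne₁ → Σ-agree T₂ λ S₂ S₂⊆T₂ ne₂ →
         F≡G S₁ S₂ S₁⊆T₁ S₂⊆T₂ ne₁ ne₂) ⟩
  Σ⊆ T₁ (λ S₁ → Σ⊆ T₂ (G S₁) + (F S₁ ⊥ - G S₁ ⊥))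
    + (Σ⊆ T₂ (F ⊥) - (Σ⊆ T₂ (G ⊥) + (F ⊥ ⊥ - G ⊥ ⊥)))
    ≡⟨ cong (_+ _) (trans (Σ-+ T₁ _ _) (cong (λ x → Σ⊆ T₁ (λ S₁ → Σ⊆ T₂ (G S₁)) + x)
         (Σ-- T₁ (λ S₁ → F S₁ ⊥) (λ S₁ → G S₁ ⊥)))) ⟩
  Σ⊆ T₁ (λ S₁ → Σ⊆ T₂ (G S₁)) + (Σ⊆ T₁ (λ S₁ → F S₁ ⊥) - Σ⊆ T₁ (λ S₁ → G S₁ ⊥))
    + (Σ⊆ T₂ (F ⊥) - (Σ⊆ T₂ (G ⊥) + (F ⊥ ⊥ - G ⊥ ⊥)))
    ≡⟨ lem (Σ⊆ T₁ (λ S₁ → Σ⊆ T₂ (G S₁))) (Σ⊆ T₁ (λ S₁ → F S₁ ⊥)) (Σ⊆ T₁ (λ S₁ → G S₁ ⊥))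
           (Σ⊆ T₂ (F ⊥)) (Σ⊆ T₂ (G ⊥)) (F ⊥ ⊥) (G ⊥ ⊥) ⟩
  _ ∎
  where
  open ≡-Reasoning
  Σ-- : ∀ (T : Subset _) f g → Σ⊆ T (λ S → f S - g S) ≡ Σ⊆ T f - Σ⊆ T g
  Σ-- T f g = trans (Σ-+ T f _) (cong (λ x → Σ⊆ T f + x)
    (trans (Σ-cong T λ S _ → sym (ℤ.-1*i≡-i (g S)))
           (trans (Σ-*ˡ T (- 1ℤ) g) (ℤ.-1*i≡-i (Σ⊆ T g)))))
  lem : ∀ s f₁ g₁ f₂ g₂ f g →
        s + (f₁ - g₁) + (f₂ - (g₂ + (f - g))) ≡ s + ((f₁ + f₂ - f) - (g₁ + g₂ - g))
  lem = solve-∀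

-- Signs of integers

0≤-* : ∀ {i j} → 0ℤ ≤ i → 0ℤ ≤ j → 0ℤ ≤ i * j
0≤-* {i} {j} 0≤i 0≤j = subst (_≤ i * j) (ℤ.*-zeroˡ j)
  (ℤ.*-monoʳ-≤-nonNeg j {{nonNegative 0≤j}} 0≤i)

0≤-+ : ∀ {i j} → 0ℤ ≤ i → 0ℤ ≤ j → 0ℤ ≤ i + j
0≤-+ = ℤ.+-mono-≤

0≤+ : ∀ {m} → 0ℤ ≤ + m
0≤+ = +≤+ z≤n

diff⇒≤ : ∀ i j {k} → j - i ≡ k → 0ℤ ≤ k → i ≤ j
diff⇒≤ i j j-i≡k 0≤k = ℤ.0≤i-j⇒j≤i (subst (0ℤ ≤_) (sym j-i≡k) 0≤k)

0≤𝟙 : ∀ b → 0ℤ ≤ 𝟙 b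
0≤𝟙 true  = 0≤+
0≤𝟙 false = 0≤+

0≤1-𝟙 : ∀ b → 0ℤ ≤ 1ℤ - 𝟙 b
0≤1-𝟙 true  = 0≤+
0≤1-𝟙 false = 0≤+

∈⊎ι≡0 : ∀ v (S : Subset n) → v ∈ S ⊎ ι v S ≡ 0ℤ
∈⊎ι≡0 v S with v ∈? S
... | yes v∈S = inj₁ v∈S
... | no  _   = inj₂ refl

-- Counting connected sets along a cotree

module _ {n : ℕ} (conn : Subset n → Bool) where

  -- The counting needs nothing else from a node of a cotree, so `conn` may be any Boolean function
  -- on subsets and adjacency does not appear.
  Mixed : Bool → Subset n → Subset n → Set
  Mixed κ T₁ T₂ = ∀ S₁ S₂ → S₁ ⊆ T₁ → S₂ ⊆ T₂ → Nonempty S₁ → Nonempty S₂ →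
                  conn (S₁ ∪ S₂) ≡ κ

  -- A node is a join for κ = true and a disjoint union for κ = false.
  data Cotree : Subset n → Set where
    leaf : ∀ v → Cotree ⁅ v ⁆
    node : ∀ κ {T₁ T₂} → Disjoint T₁ T₂ → Mixed κ T₁ T₂ →
           Cotree T₁ → Cotree T₂ → Cotree (T₁ ∪ T₂)

  Mixed-sym : ∀ {κ T₁ T₂} → Mixed κ T₁ T₂ → Mixed κ T₂ T₁
  Mixed-sym m S₂ S₁ S₂⊆T₂ S₁⊆T₁ ne₂ ne₁ =
    trans (cong conn (∪-comm S₂ S₁)) (m S₁ S₂ S₁⊆T₁ S₂⊆T₂ ne₁ ne₂)

  Cotree⇒Nonempty : ∀ {T} → Cotree T → Nonempty T
  Cotree⇒Nonempty (leaf v) = v , x∈⁅x⁆ v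
  Cotree⇒Nonempty (node κ _ _ t₁ _) = let (x , x∈T₁) = Cotree⇒Nonempty t₁ in x , p⊆p∪q _ x∈T₁

  χ : Subset n → ℤ
  χ S = 𝟙 (conn S)

  -- For c = - m, being at most 0 says that the sets counted have average size at most m / 2. The
  -- offset c is independent of T, because a node hands its own offset down to its parts.
  disconnectedAt : Fin n → ℤ → Subset n → ℤ
  disconnectedAt v c T = Σ⊆ T λ S → (1ℤ - χ S) * (ι v S * (c + + 2 * + ∣ S ∣))

  connectedSum : ℤ → Subset n → ℤ
  connectedSum c T = Σ⊆ T λ S → χ S * (c + + 2 * + ∣ S ∣)

  disconnectedAt-mono : ∀ v {c d} T → c ≤ d → disconnectedAt v c T ≤ disconnectedAt v d T
  disconnectedAt-mono v {c} {d} T c≤d = Σ-mono T λ S _ →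
    ℤ.*-monoˡ-≤-nonNeg (1ℤ - χ S) {{nonNegative (0≤1-𝟙 (conn S))}}
      (ℤ.*-monoˡ-≤-nonNeg (ι v S) {{nonNegative (0≤𝟙 (does (v ∈? S)))}}
        (ℤ.+-monoˡ-≤ (+ 2 * + ∣ S ∣) c≤d))

  -- A set containing v already meets T₁. If it misses T₂, it is counted in the last summand;
  -- otherwise it is mixed and counts exactly when `κ` is `false`. The bracket is the sum over all
  -- pairs with v in the first component, less the pairs whose second component is empty.
  disconnectedAt-∪ : ∀ {κ T₁ T₂ v} → Disjoint T₁ T₂ → Mixed κ T₁ T₂ → v ∈ T₁ → ∀ c →
    disconnectedAt v c (T₁ ∪ T₂) ≡
      (1ℤ - 𝟙 κ) * (Σ⊆ T₁ (ι v) * (2^∣ T₂ ∣ * (c + + ∣ T₂ ∣ + + ∣ T₁ ∣ + 1ℤ) - (c + + ∣ T₁ ∣ + 1ℤ)))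
        + disconnectedAt v c T₁
  disconnectedAt-∪ {κ} {T₁} {T₂} {v} d m v∈T₁ c = begin
    disconnectedAt v c (T₁ ∪ T₂)
      ≡⟨ Σ-∪ T₁ T₂ F d ⟩
    Σ⊆ T₁ (λ S₁ → Σ⊆ T₂ λ S₂ → F (S₁ ∪ S₂))
      ≡⟨ Σ-cong T₁ inner ⟩
    Σ⊆ T₁ (λ S₁ → μ * q * g (c + + ∣ T₂ ∣) S₁ + (- μ * g c S₁ + F S₁))
      ≡⟨ trans (Σ-+ T₁ _ _) (cong₂ _+_ (Σ-*ˡ T₁ (μ * q) (g (c + + ∣ T₂ ∣)))
           (trans (Σ-+ T₁ _ _) (cong (_+ disconnectedAt v c T₁) (Σ-*ˡ T₁ (- μ) (g c))))) ⟩
    μ * q * Σ⊆ T₁ (g (c + + ∣ T₂ ∣)) + (- μ * Σ⊆ T₁ (g c) + disconnectedAt v c T₁)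
      ≡⟨ cong₂ (λ x y → μ * q * x + (- μ * y + disconnectedAt v c T₁))
           (Σ-ι-affine v∈T₁ (c + + ∣ T₂ ∣)) (Σ-ι-affine v∈T₁ c) ⟩
    μ * q * (V * (c + + ∣ T₂ ∣ + + ∣ T₁ ∣ + 1ℤ)) + (- μ * (V * (c + + ∣ T₁ ∣ + 1ℤ)) + disconnectedAt v c T₁)
      ≡⟨ lem₂ μ q V (c + + ∣ T₂ ∣ + + ∣ T₁ ∣ + 1ℤ) (c + + ∣ T₁ ∣ + 1ℤ) (disconnectedAt v c T₁) ⟩
    _ ∎
    where
    open ≡-Reasoning
    μ = 1ℤ - 𝟙 κ
    q = 2^∣ T₂ ∣
    V = Σ⊆ T₁ (ι v)
    g : ℤ → Subset n → ℤ
    g c S = ι v S * (c + + 2 * + ∣ S ∣)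
    F : Subset n → ℤ
    F S = (1ℤ - χ S) * g c S

    lem₂ : ∀ μ q V a b x → μ * q * (V * a) + (- μ * (V * b) + x) ≡ μ * (V * (q * a - b)) + x
    lem₂ = solve-∀

    ι-∪ : ∀ S₁ S₂ → S₂ ⊆ T₂ → ι v (S₁ ∪ S₂) ≡ ι v S₁
    ι-∪ S₁ S₂ S₂⊆T₂ with v ∈? S₁
    ... | yes v∈S₁ = cong 𝟙 (dec-true (v ∈? (S₁ ∪ S₂)) (p⊆p∪q S₂ v∈S₁))
    ... | no  v∉S₁ = cong 𝟙 (dec-false (v ∈? (S₁ ∪ S₂))
      ([ v∉S₁ , (λ v∈S₂ → d v∈T₁ (S₂⊆T₂ v∈S₂)) ]′ ∘ x∈p∪q⁻ S₁ S₂))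

    h : Subset n → Subset n → ℤ
    h S₁ S₂ = μ * ι v S₁ * ((c + + 2 * + ∣ S₁ ∣) + + 2 * + ∣ S₂ ∣)

    F≡h : ∀ S₁ S₂ → S₁ ⊆ T₁ → S₂ ⊆ T₂ → Nonempty S₂ → F (S₁ ∪ S₂) ≡ h S₁ S₂
    F≡h S₁ S₂ S₁⊆T₁ S₂⊆T₂ ne₂ = trans
      (cong₂ (λ i s → (1ℤ - χ (S₁ ∪ S₂)) * (i * (c + + 2 * s))) (ι-∪ S₁ S₂ S₂⊆T₂)
        (∣∪∣ S₁ S₂ λ x∈S₁ x∈S₂ → d (S₁⊆T₁ x∈S₁) (S₂⊆T₂ x∈S₂)))
      -- `Mixed` says nothing about an empty S₁. If v ∈ S₁, then v is the required witness;
      -- otherwise both sides vanish through the factor `ι v S₁`.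
      ([ (λ v∈S₁ → trans (cong (λ x → (1ℤ - 𝟙 x) * (ι v S₁ * (c + + 2 * (+ ∣ S₁ ∣ + + ∣ S₂ ∣))))
                            (m S₁ S₂ S₁⊆T₁ S₂⊆T₂ (v , v∈S₁) ne₂))
                   (lem μ (ι v S₁) c (+ ∣ S₁ ∣) (+ ∣ S₂ ∣)))
       , (λ ι≡0 → subst
           (λ i → (1ℤ - χ (S₁ ∪ S₂)) * (i * (c + + 2 * (+ ∣ S₁ ∣ + + ∣ S₂ ∣))) ≡
                  μ * i * ((c + + 2 * + ∣ S₁ ∣) + + 2 * + ∣ S₂ ∣))
           (sym ι≡0) (lem₀ μ (1ℤ - χ (S₁ ∪ S₂)) c (+ ∣ S₁ ∣) (+ ∣ S₂ ∣)))
       ]′ (∈⊎ι≡0 v S₁))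
      where
      lem : ∀ μ i c s t → μ * (i * (c + + 2 * (s + t))) ≡ μ * i * (c + + 2 * s + + 2 * t)
      lem = solve-∀
      lem₀ : ∀ μ x c s t → x * (0ℤ * (c + + 2 * (s + t))) ≡ μ * 0ℤ * (c + + 2 * s + + 2 * t)
      lem₀ = solve-∀

    inner : ∀ S₁ → S₁ ⊆ T₁ →
      Σ⊆ T₂ (λ S₂ → F (S₁ ∪ S₂)) ≡ μ * q * g (c + + ∣ T₂ ∣) S₁ + (- μ * g c S₁ + F S₁)
    inner S₁ S₁⊆T₁ = begin
      Σ⊆ T₂ (λ S₂ → F (S₁ ∪ S₂))
        ≡⟨ Σ-agree T₂ {g = h S₁} (λ S₂ S₂⊆T₂ → F≡h S₁ S₂ S₁⊆T₁ S₂⊆T₂) ⟩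
      Σ⊆ T₂ (h S₁) + (F (S₁ ∪ ⊥) - h S₁ ⊥)
        ≡⟨ cong₂ (λ x y → x + (y - h S₁ ⊥))
             (trans (Σ-*ˡ T₂ (μ * ι v S₁) _) (cong (μ * ι v S₁ *_) (Σ-affine T₂ (c + + 2 * + ∣ S₁ ∣))))
             (cong F (∪-identityʳ S₁)) ⟩
      μ * ι v S₁ * (q * (c + + 2 * + ∣ S₁ ∣ + + ∣ T₂ ∣)) + (F S₁ - h S₁ ⊥)
        ≡⟨ cong (λ x → μ * ι v S₁ * (q * (c + + 2 * + ∣ S₁ ∣ + + ∣ T₂ ∣)) +
                       (F S₁ - μ * ι v S₁ * ((c + + 2 * + ∣ S₁ ∣) + + 2 * + x))) (∣⊥∣≡0 n) ⟩
      μ * ι v S₁ * (q * (c + + 2 * + ∣ S₁ ∣ + + ∣ T₂ ∣))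
        + (F S₁ - μ * ι v S₁ * ((c + + 2 * + ∣ S₁ ∣) + + 2 * 0ℤ))
        ≡⟨ lem μ (ι v S₁) q c (+ ∣ S₁ ∣) (+ ∣ T₂ ∣) (F S₁) ⟩
      _ ∎
      where
      lem : ∀ μ i q c s t F → μ * i * (q * (c + + 2 * s + t)) + (F - μ * i * ((c + + 2 * s) + + 2 * 0ℤ))
            ≡ μ * q * (i * (c + t + + 2 * s)) + (- μ * (i * (c + + 2 * s)) + F)
      lem = solve-∀

  connectedCount : Subset n → ℤ
  connectedCount T = Σ⊆ T χ

  connectedSum-shift : ∀ c k T → connectedSum (c + k) T ≡ connectedSum c T + k * connectedCount T
  connectedSum-shift c k T = begin
    Σ⊆ T (λ S → χ S * (c + k + + 2 * + ∣ S ∣))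
      ≡⟨ Σ-cong T (λ S _ → lem (χ S) c k (+ ∣ S ∣)) ⟩
    Σ⊆ T (λ S → χ S * (c + + 2 * + ∣ S ∣) + k * χ S)
      ≡⟨ Σ-+ T _ _ ⟩
    connectedSum c T + Σ⊆ T (λ S → k * χ S)
      ≡⟨ cong (λ x → connectedSum c T + x) (Σ-*ˡ T k χ) ⟩
    connectedSum c T + k * connectedCount T ∎
    where
    open ≡-Reasoning
    lem : ∀ x c k s → x * (c + k + + 2 * s) ≡ x * (c + + 2 * s) + k * x
    lem = solve-∀

  -- The count is the slope of `connectedSum` in its offset, so the formula for the count at a node
  -- can be read off from the one for the sum.
  connectedCount≡ : ∀ T → connectedCount T ≡ connectedSum 1ℤ T - connectedSum 0ℤ T
  connectedCount≡ T = trans (lem (connectedCount T) (connectedSum 0ℤ T)) (cong (_- connectedSum 0ℤ T) (sym (connectedSum-shift 0ℤ 1ℤ T)))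
    where
    lem : ∀ m e → m ≡ e + 1ℤ * m - e
    lem = solve-∀

  connectedSum≡ : ∀ c T → connectedSum (- c) T ≡ + 2 * Σ⊆ T (λ S → χ S * + ∣ S ∣) - c * connectedCount T
  connectedSum≡ c T = begin
    connectedSum (- c) T
      ≡⟨ Σ-cong T (λ S _ → lem₁ (χ S) c (+ ∣ S ∣)) ⟩
    Σ⊆ T (λ S → + 2 * (χ S * + ∣ S ∣) + - c * χ S)
      ≡⟨ Σ-+ T (λ S → + 2 * (χ S * + ∣ S ∣)) (λ S → - c * χ S) ⟩
    Σ⊆ T (λ S → + 2 * (χ S * + ∣ S ∣)) + Σ⊆ T (λ S → - c * χ S)
      ≡⟨ cong₂ _+_ (Σ-*ˡ T (+ 2) (λ S → χ S * + ∣ S ∣)) (Σ-*ˡ T (- c) χ) ⟩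
    + 2 * Σ⊆ T (λ S → χ S * + ∣ S ∣) + - c * connectedCount T
      ≡⟨ lem₂ (+ 2 * Σ⊆ T (λ S → χ S * + ∣ S ∣)) c (connectedCount T) ⟩
    + 2 * Σ⊆ T (λ S → χ S * + ∣ S ∣) - c * connectedCount T ∎
    where
    open ≡-Reasoning
    lem₁ : ∀ x c s → x * (- c + + 2 * s) ≡ + 2 * (x * s) + - c * x
    lem₁ = solve-∀
    lem₂ : ∀ a c b → a + - c * b ≡ a - c * b
    lem₂ = solve-∀

  -- All subsets of T containing v together have average size (∣ T ∣ + 1) / 2, so an
  -- upper bound for the disconnected ones is a lower bound for the connected ones.
  disconnectedAt≡ : ∀ {T v} → v ∈ T → disconnectedAt v (- (1ℤ + + ∣ T ∣)) T ≡
    (1ℤ + + ∣ T ∣) * Σ⊆ T (λ S → ι v S * χ S) - + 2 * Σ⊆ T (λ S → ι v S * (χ S * + ∣ S ∣))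
  disconnectedAt≡ {T} {v} v∈T = begin
    disconnectedAt v c T
      ≡⟨ Σ-cong T (λ S _ → lem₁ (χ S) (ι v S) c (+ ∣ S ∣)) ⟩
    Σ⊆ T (λ S → f S + (g S + h S))
      ≡⟨ Σ-+ T f (λ S → g S + h S) ⟩
    Σ⊆ T f + Σ⊆ T (λ S → g S + h S)
      ≡⟨ cong₂ _+_ (Σ-ι-affine v∈T c) (trans (Σ-+ T g h)
           (cong₂ _+_ (Σ-*ˡ T (- c) (λ S → ι v S * χ S))
                      (Σ-*ˡ T (- + 2) (λ S → ι v S * (χ S * + ∣ S ∣))))) ⟩
    Σ⊆ T (ι v) * (c + + ∣ T ∣ + 1ℤ)
      + (- c * Σ⊆ T (λ S → ι v S * χ S) + - + 2 * Σ⊆ T (λ S → ι v S * (χ S * + ∣ S ∣)))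
      ≡⟨ lem₂ (Σ⊆ T (ι v)) (+ ∣ T ∣) (Σ⊆ T (λ S → ι v S * χ S))
              (Σ⊆ T (λ S → ι v S * (χ S * + ∣ S ∣))) ⟩
    _ ∎
    where
    open ≡-Reasoning
    c = - (1ℤ + + ∣ T ∣)
    f g h : Subset n → ℤ
    f S = ι v S * (c + + 2 * + ∣ S ∣)
    g S = - c * (ι v S * χ S)
    h S = - + 2 * (ι v S * (χ S * + ∣ S ∣))
    lem₁ : ∀ x i c s → (1ℤ - x) * (i * (c + + 2 * s)) ≡
      i * (c + + 2 * s) + (- c * (i * x) + - + 2 * (i * (x * s)))
    lem₁ = solve-∀
    lem₂ : ∀ V t a b → V * (- (1ℤ + t) + t + 1ℤ) + (- (- (1ℤ + t)) * a + - + 2 * b) ≡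
           (1ℤ + t) * a - + 2 * b
    lem₂ = solve-∀

  module _ (conn-⊥ : conn ⊥ ≡ false) where

    -- The bracket sums over the pairs of nonempty subsets: all pairs, minus the two axes where one
    -- component is empty, plus the doubly removed pair of empty sets. The axes themselves give the
    -- sums over T₁ and T₂; they share only ⊥, which contributes 0 by `conn-⊥`.
    connectedSum-∪ : ∀ {κ T₁ T₂} → Disjoint T₁ T₂ → Mixed κ T₁ T₂ → ∀ c →
      connectedSum c (T₁ ∪ T₂) ≡
        𝟙 κ * (2^∣ T₁ ∣ * (2^∣ T₂ ∣ * (c + + ∣ T₁ ∣ + + ∣ T₂ ∣))
                - 2^∣ T₁ ∣ * (c + + ∣ T₁ ∣) - 2^∣ T₂ ∣ * (c + + ∣ T₂ ∣) + c)
          + (connectedSum c T₁ + connectedSum c T₂)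
    connectedSum-∪ {κ} {T₁} {T₂} d m c = begin
      connectedSum c (T₁ ∪ T₂)
        ≡⟨ Σ-∪ T₁ T₂ F d ⟩
      Σ⊆ T₁ (λ S₁ → Σ⊆ T₂ λ S₂ → F (S₁ ∪ S₂))
        ≡⟨ Σ-agree₂ T₁ T₂ (λ S₁ S₂ → F (S₁ ∪ S₂)) G F≡G ⟩
      Σ⊆ T₁ (λ S₁ → Σ⊆ T₂ (G S₁))
        + ((Σ⊆ T₁ (λ S₁ → F (S₁ ∪ ⊥)) + Σ⊆ T₂ (λ S₂ → F (⊥ ∪ S₂)) - F (⊥ ∪ ⊥))
           - (Σ⊆ T₁ (λ S₁ → G S₁ ⊥) + Σ⊆ T₂ (G ⊥) - G ⊥ ⊥))
        ≡⟨ cong₂ (λ x y → x + y) ΣΣG (cong₂ (λ x y → x - y) ΣF ΣG) ⟩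
      k * (p * (q * (c + + ∣ T₁ ∣ + + ∣ T₂ ∣)))
        + ((connectedSum c T₁ + connectedSum c T₂ - 0ℤ * (c + + 2 * 0ℤ))
           - (k * (p * (c + + ∣ T₁ ∣)) + k * (q * (c + + ∣ T₂ ∣)) - k * c))
        ≡⟨ lem k (p * (q * (c + + ∣ T₁ ∣ + + ∣ T₂ ∣))) (connectedSum c T₁ + connectedSum c T₂)
               (p * (c + + ∣ T₁ ∣)) (q * (c + + ∣ T₂ ∣)) c ⟩
      _ ∎
      where
      open ≡-Reasoning
      k = 𝟙 κ
      p = 2^∣ T₁ ∣
      q = 2^∣ T₂ ∣
      F : Subset n → ℤ
      F S = χ S * (c + + 2 * + ∣ S ∣)
      G : Subset n → Subset n → ℤ
      G S₁ S₂ = k * (c + + 2 * + ∣ S₁ ∣ + + 2 * + ∣ S₂ ∣)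

      lem : ∀ k x e y z c → k * x + ((e - 0ℤ * (c + + 2 * 0ℤ)) - (k * y + k * z - k * c))
            ≡ k * (x - y - z + c) + e
      lem = solve-∀

      F≡G : ∀ S₁ S₂ → S₁ ⊆ T₁ → S₂ ⊆ T₂ → Nonempty S₁ → Nonempty S₂ → F (S₁ ∪ S₂) ≡ G S₁ S₂
      F≡G S₁ S₂ S₁⊆T₁ S₂⊆T₂ ne₁ ne₂ = trans
        (cong₂ (λ x s → 𝟙 x * (c + + 2 * s)) (m S₁ S₂ S₁⊆T₁ S₂⊆T₂ ne₁ ne₂)
          (∣∪∣ S₁ S₂ λ x∈S₁ x∈S₂ → d (S₁⊆T₁ x∈S₁) (S₂⊆T₂ x∈S₂)))
        (lem′ k c (+ ∣ S₁ ∣) (+ ∣ S₂ ∣))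
        where
        lem′ : ∀ k c s t → k * (c + + 2 * (s + t)) ≡ k * (c + + 2 * s + + 2 * t)
        lem′ = solve-∀

      ΣΣG : Σ⊆ T₁ (λ S₁ → Σ⊆ T₂ (G S₁)) ≡ k * (p * (q * (c + + ∣ T₁ ∣ + + ∣ T₂ ∣)))
      ΣΣG = begin
        Σ⊆ T₁ (λ S₁ → Σ⊆ T₂ (G S₁))
          ≡⟨ Σ-cong T₁ (λ S₁ _ → trans (Σ-*ˡ T₂ k (λ S₂ → c + + 2 * + ∣ S₁ ∣ + + 2 * + ∣ S₂ ∣))
               (trans (cong (k *_) (Σ-affine T₂ (c + + 2 * + ∣ S₁ ∣)))
                      (lem₁ k q c (+ ∣ S₁ ∣) (+ ∣ T₂ ∣)))) ⟩
        Σ⊆ T₁ (λ S₁ → k * q * (c + + ∣ T₂ ∣ + + 2 * + ∣ S₁ ∣))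
          ≡⟨ Σ-*ˡ T₁ (k * q) (λ S₁ → c + + ∣ T₂ ∣ + + 2 * + ∣ S₁ ∣) ⟩
        k * q * Σ⊆ T₁ (λ S₁ → c + + ∣ T₂ ∣ + + 2 * + ∣ S₁ ∣)
          ≡⟨ cong (k * q *_) (Σ-affine T₁ (c + + ∣ T₂ ∣)) ⟩
        k * q * (p * (c + + ∣ T₂ ∣ + + ∣ T₁ ∣))
          ≡⟨ lem₂ k p q c (+ ∣ T₁ ∣) (+ ∣ T₂ ∣) ⟩
        k * (p * (q * (c + + ∣ T₁ ∣ + + ∣ T₂ ∣))) ∎
        where
        lem₁ : ∀ k q c s t → k * (q * (c + + 2 * s + t)) ≡ k * q * (c + t + + 2 * s)
        lem₁ = solve-∀
        lem₂ : ∀ k p q c s t → k * q * (p * (c + t + s)) ≡ k * (p * (q * (c + s + t)))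
        lem₂ = solve-∀

      ΣF : Σ⊆ T₁ (λ S₁ → F (S₁ ∪ ⊥)) + Σ⊆ T₂ (λ S₂ → F (⊥ ∪ S₂)) - F (⊥ ∪ ⊥) ≡
           connectedSum c T₁ + connectedSum c T₂ - 0ℤ * (c + + 2 * 0ℤ)
      ΣF = cong₂ (λ x y → x - y)
        (cong₂ (λ x y → x + y)
          (Σ-cong T₁ λ S₁ _ → cong F (∪-identityʳ S₁))
          (Σ-cong T₂ λ S₂ _ → cong F (∪-identityˡ S₂)))
        (trans (cong F (∪-identityˡ ⊥))
               (cong₂ (λ x s → 𝟙 x * (c + + 2 * + s)) conn-⊥ (∣⊥∣≡0 n)))

      ΣG : Σ⊆ T₁ (λ S₁ → G S₁ ⊥) + Σ⊆ T₂ (G ⊥) - G ⊥ ⊥ ≡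
           k * (p * (c + + ∣ T₁ ∣)) + k * (q * (c + + ∣ T₂ ∣)) - k * c
      ΣG = begin
        Σ⊆ T₁ (λ S₁ → G S₁ ⊥) + Σ⊆ T₂ (G ⊥) - G ⊥ ⊥
          ≡⟨ cong (λ e → Σ⊆ T₁ (λ S₁ → k * (c + + 2 * + ∣ S₁ ∣ + + 2 * + e))
                       + Σ⊆ T₂ (λ S₂ → k * (c + + 2 * + e + + 2 * + ∣ S₂ ∣))
                       - k * (c + + 2 * + e + + 2 * + e)) (∣⊥∣≡0 n) ⟩
        Σ⊆ T₁ (λ S₁ → k * (c + + 2 * + ∣ S₁ ∣ + + 2 * 0ℤ))
          + Σ⊆ T₂ (λ S₂ → k * (c + + 2 * 0ℤ + + 2 * + ∣ S₂ ∣))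
          - k * (c + + 2 * 0ℤ + + 2 * 0ℤ)
          ≡⟨ cong₂ (λ x y → x + y - k * (c + + 2 * 0ℤ + + 2 * 0ℤ))
               (axis T₁ λ S → lem₁ k c (+ ∣ S ∣))
               (axis T₂ λ S → lem₂ k c (+ ∣ S ∣)) ⟩
        k * (p * (c + + ∣ T₁ ∣)) + k * (q * (c + + ∣ T₂ ∣)) - k * (c + + 2 * 0ℤ + + 2 * 0ℤ)
          ≡⟨ lem₃ k c (k * (p * (c + + ∣ T₁ ∣)) + k * (q * (c + + ∣ T₂ ∣))) ⟩
        k * (p * (c + + ∣ T₁ ∣)) + k * (q * (c + + ∣ T₂ ∣)) - k * c ∎
        where
        axis : ∀ T {f} → (∀ S → f S ≡ k * (c + + 2 * + ∣ S ∣)) →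
               Σ⊆ T f ≡ k * (2^∣ T ∣ * (c + + ∣ T ∣))
        axis T eq = trans (Σ-cong T λ S _ → eq S)
          (trans (Σ-*ˡ T k λ S → c + + 2 * + ∣ S ∣) (cong (k *_) (Σ-affine T c)))
        lem₁ : ∀ k c s → k * (c + + 2 * s + + 2 * 0ℤ) ≡ k * (c + + 2 * s)
        lem₁ = solve-∀
        lem₂ : ∀ k c s → k * (c + + 2 * 0ℤ + + 2 * s) ≡ k * (c + + 2 * s)
        lem₂ = solve-∀
        lem₃ : ∀ k c e → e - k * (c + + 2 * 0ℤ + + 2 * 0ℤ) ≡ e - k * c
        lem₃ = solve-∀

    connectedCount-∪ : ∀ {κ T₁ T₂} → Disjoint T₁ T₂ → Mixed κ T₁ T₂ →
      connectedCount (T₁ ∪ T₂) ≡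
        𝟙 κ * ((2^∣ T₁ ∣ - 1ℤ) * (2^∣ T₂ ∣ - 1ℤ)) + (connectedCount T₁ + connectedCount T₂)
    connectedCount-∪ {κ} {T₁} {T₂} d m = begin
      connectedCount (T₁ ∪ T₂)
        ≡⟨ connectedCount≡ (T₁ ∪ T₂) ⟩
      connectedSum 1ℤ (T₁ ∪ T₂) - connectedSum 0ℤ (T₁ ∪ T₂)
        ≡⟨ cong₂ (λ x y → x - y) (connectedSum-∪ d m 1ℤ) (connectedSum-∪ d m 0ℤ) ⟩
      _ ≡⟨ lem (𝟙 κ) 2^∣ T₁ ∣ 2^∣ T₂ ∣ (+ ∣ T₁ ∣) (+ ∣ T₂ ∣)
             (connectedSum 1ℤ T₁) (connectedSum 0ℤ T₁) (connectedSum 1ℤ T₂) (connectedSum 0ℤ T₂) ⟩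
      𝟙 κ * ((2^∣ T₁ ∣ - 1ℤ) * (2^∣ T₂ ∣ - 1ℤ))
        + ((connectedSum 1ℤ T₁ - connectedSum 0ℤ T₁) + (connectedSum 1ℤ T₂ - connectedSum 0ℤ T₂))
        ≡⟨ cong₂ (λ x y → 𝟙 κ * ((2^∣ T₁ ∣ - 1ℤ) * (2^∣ T₂ ∣ - 1ℤ)) + (x + y))
             (connectedCount≡ T₁) (connectedCount≡ T₂) ⟨
      _ ∎
      where
      open ≡-Reasoning
      lem : ∀ k p q s t a b a′ b′ →
        k * (p * (q * (1ℤ + s + t)) - p * (1ℤ + s) - q * (1ℤ + t) + 1ℤ) + (a + a′)
          - (k * (p * (q * (0ℤ + s + t)) - p * (0ℤ + s) - q * (0ℤ + t) + 0ℤ) + (b + b′))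
        ≡ k * ((p - 1ℤ) * (q - 1ℤ)) + ((a - b) + (a′ - b′))
      lem = solve-∀

    connectedCount≥0 : ∀ T → 0ℤ ≤ connectedCount T
    connectedCount≥0 T = Σ-nonneg T λ S _ → 0≤𝟙 (conn S)

    -- Bounds for the average sizes

    module _ (conn-⁅⁆ : ∀ v → conn ⁅ v ⁆ ≡ true) where

      -- The leaves contribute their singletons, and mixed sets can only add to the count. The bound
      -- compensates for the mixed sets of a join in `connectedSum≤0`, and shows that connected sets
      -- avoiding v exist.
      ∣T∣≤connectedCount : ∀ {T} → Cotree T → + ∣ T ∣ ≤ connectedCount T
      ∣T∣≤connectedCount (leaf v) = ℤ.≤-reflexive (sym (trans (Σ-⁅⁆ v χ)
        (trans (cong₂ (λ x y → 𝟙 x + 𝟙 y) conn-⊥ (conn-⁅⁆ v)) (sym (cong +_ (∣⁅x⁆∣≡1 v))))))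
      ∣T∣≤connectedCount (node κ {T₁} {T₂} d m t₁ t₂) = begin
        + ∣ T₁ ∪ T₂ ∣
          ≡⟨ ∣∪∣ T₁ T₂ d ⟩
        + ∣ T₁ ∣ + + ∣ T₂ ∣
          ≤⟨ ℤ.+-mono-≤ (∣T∣≤connectedCount t₁) (∣T∣≤connectedCount t₂) ⟩
        connectedCount T₁ + connectedCount T₂
          ≡⟨ ℤ.+-identityˡ (connectedCount T₁ + connectedCount T₂) ⟨
        0ℤ + (connectedCount T₁ + connectedCount T₂)
          ≤⟨ ℤ.+-monoˡ-≤ (connectedCount T₁ + connectedCount T₂)
               (0≤-* (0≤𝟙 κ) (0≤-* (1≤2^ T₁) (1≤2^ T₂))) ⟩
        _ ≡⟨ connectedCount-∪ d m ⟨
        connectedCount (T₁ ∪ T₂) ∎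
        where
        open ℤ.≤-Reasoning
        1≤2^ : ∀ T → 0ℤ ≤ 2^∣ T ∣ - 1ℤ
        1≤2^ T = ℤ.i≤j⇒0≤j-i (ℤ.≤-trans (ℤ.i≤i+j 1ℤ (+ ∣ T ∣)) (1+∣T∣≤2^∣T∣ T))

      -- Connected subsets of T have average size at most (∣ T ∣ + 1) / 2.
      connectedSum≤0 : ∀ {T} → Cotree T → connectedSum (- (1ℤ + + ∣ T ∣)) T ≤ 0ℤ
      connectedSum≤0 (leaf v) = ℤ.≤-reflexive (trans (Σ-⁅⁆ v _)
        (trans (cong₂ (λ x y → 𝟙 x * (c + + 2 * + ∣ ⊥ {n} ∣) + 𝟙 y * (c + + 2 * + ∣ ⁅ v ⁆ ∣))
                 conn-⊥ (conn-⁅⁆ v))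
               (cong (λ x → 0ℤ * (- (1ℤ + + x) + + 2 * + ∣ ⊥ {n} ∣) + 1ℤ * (- (1ℤ + + x) + + 2 * + x))
                 (∣⁅x⁆∣≡1 v))))
        where
        c = - (1ℤ + + ∣ ⁅ v ⁆ ∣)
      connectedSum≤0 (node κ {T₁} {T₂} d m t₁ t₂) = begin
        connectedSum (- (1ℤ + + ∣ T₁ ∪ T₂ ∣)) (T₁ ∪ T₂)
          ≡⟨ cong (λ x → connectedSum (- (1ℤ + x)) (T₁ ∪ T₂)) (∣∪∣ T₁ T₂ d) ⟩
        connectedSum (- (1ℤ + (s + t))) (T₁ ∪ T₂)
          ≡⟨ connectedSum-∪ d m (- (1ℤ + (s + t))) ⟩
        𝟙 κ * (x * (y * (- (1ℤ + (s + t)) + s + t)) - x * (- (1ℤ + (s + t)) + s)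
                - y * (- (1ℤ + (s + t)) + t) + - (1ℤ + (s + t)))
          + (connectedSum (- (1ℤ + (s + t))) T₁ + connectedSum (- (1ℤ + (s + t))) T₂)
          ≡⟨ cong₂ (λ a b → 𝟙 κ * (x * (y * (- (1ℤ + (s + t)) + s + t)) - x * (- (1ℤ + (s + t)) + s)
                                    - y * (- (1ℤ + (s + t)) + t) + - (1ℤ + (s + t))) + (a + b))
               (trans (cong (λ c → connectedSum c T₁) (lem₁ s t)) (connectedSum-shift (- (1ℤ + s)) (- t) T₁))
               (trans (cong (λ c → connectedSum c T₂) (lem₂ s t)) (connectedSum-shift (- (1ℤ + t)) (- s) T₂)) ⟩
        𝟙 κ * (x * (y * (- (1ℤ + (s + t)) + s + t)) - x * (- (1ℤ + (s + t)) + s)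
                - y * (- (1ℤ + (s + t)) + t) + - (1ℤ + (s + t)))
          + ((E₁ + - t * N₁) + (E₂ + - s * N₂))
          ≤⟨ ℤ.0≤i-j⇒j≤i (bound κ) ⟩
        0ℤ ∎
        where
        open ℤ.≤-Reasoning
        s = + ∣ T₁ ∣
        t = + ∣ T₂ ∣
        x = 2^∣ T₁ ∣
        y = 2^∣ T₂ ∣
        N₁ = connectedCount T₁
        N₂ = connectedCount T₂
        E₁ = connectedSum (- (1ℤ + s)) T₁
        E₂ = connectedSum (- (1ℤ + t)) T₂
        lem₁ : ∀ s t → - (1ℤ + (s + t)) ≡ - (1ℤ + s) + - t
        lem₁ = solve-∀
        lem₂ : ∀ s t → - (1ℤ + (s + t)) ≡ - (1ℤ + t) + - s
        lem₂ = solve-∀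
        0≤E₁ : 0ℤ ≤ 0ℤ - E₁
        0≤E₁ = ℤ.i≤j⇒0≤j-i (connectedSum≤0 t₁)
        0≤E₂ : 0ℤ ≤ 0ℤ - E₂
        0≤E₂ = ℤ.i≤j⇒0≤j-i (connectedSum≤0 t₂)
        bound : ∀ κ → 0ℤ ≤ 0ℤ -
          (𝟙 κ * (x * (y * (- (1ℤ + (s + t)) + s + t)) - x * (- (1ℤ + (s + t)) + s)
                - y * (- (1ℤ + (s + t)) + t) + - (1ℤ + (s + t)))
          + ((E₁ + - t * N₁) + (E₂ + - s * N₂)))
        -- A union has no connected mixed sets, and enlarging T₁ to T₁ ∪ T₂ relaxes the bound by t
        -- for each of the N₁ connected sets in T₁; likewise for T₂.
        bound false = subst (0ℤ ≤_) (lem u s t N₁ N₂ E₁ E₂)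
          (0≤-+ (0≤-+ 0≤E₁ 0≤E₂)
            (0≤-+ (0≤-* {t} 0≤+ (connectedCount≥0 T₁)) (0≤-* {s} 0≤+ (connectedCount≥0 T₂))))
          where
          u = x * (y * (- (1ℤ + (s + t)) + s + t)) - x * (- (1ℤ + (s + t)) + s)
                - y * (- (1ℤ + (s + t)) + t) + - (1ℤ + (s + t))
          lem : ∀ u s t N₁ N₂ E₁ E₂ → (0ℤ - E₁) + (0ℤ - E₂) + (t * N₁ + s * N₂) ≡
            0ℤ - (0ℤ * u + ((E₁ + - t * N₁) + (E₂ + - s * N₂)))
          lem = solve-∀
        -- The mixed sets alone can violate the bound: their slack is (x - (1 + s)) * (y - (1 + t))
        -- - s * t. The relaxation t * N₁ + s * N₂ is at least 2 * s * t, since N₁ ≥ s and N₂ ≥ t,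
        -- and this leaves s * t to spare.
        bound true = subst (0ℤ ≤_) (lem x y s t N₁ N₂ E₁ E₂)
          (0≤-+ (0≤-+ 0≤E₁ 0≤E₂)
            (0≤-+ (0≤-+ (0≤-* (ℤ.i≤j⇒0≤j-i (1+∣T∣≤2^∣T∣ T₁)) (ℤ.i≤j⇒0≤j-i (1+∣T∣≤2^∣T∣ T₂)))
                        (0≤-* {s} {t} 0≤+ 0≤+))
                  (0≤-+ (0≤-* {t} 0≤+ (ℤ.i≤j⇒0≤j-i (∣T∣≤connectedCount t₁)))
                        (0≤-* {s} 0≤+ (ℤ.i≤j⇒0≤j-i (∣T∣≤connectedCount t₂))))))
          where
          lem : ∀ x y s t N₁ N₂ E₁ E₂ →
            (0ℤ - E₁) + (0ℤ - E₂) +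
              (((x - (1ℤ + s)) * (y - (1ℤ + t)) + s * t) + (t * (N₁ - s) + s * (N₂ - t))) ≡
            0ℤ - (1ℤ * (x * (y * (- (1ℤ + (s + t)) + s + t)) - x * (- (1ℤ + (s + t)) + s)
                - y * (- (1ℤ + (s + t)) + t) + - (1ℤ + (s + t)))
              + ((E₁ + - t * N₁) + (E₂ + - s * N₂)))
          lem = solve-∀

      disconnectedAt-⁅⁆ : ∀ v c → disconnectedAt v c ⁅ v ⁆ ≡ 0ℤ
      disconnectedAt-⁅⁆ v c = trans (Σ-⁅⁆ v _) (trans
        (cong₂ (λ a b → (1ℤ - χ ⊥) * (𝟙 a * (c + + 2 * + ∣ ⊥ {n} ∣))
                          + (1ℤ - 𝟙 b) * (ι v ⁅ v ⁆ * (c + + 2 * + ∣ ⁅ v ⁆ ∣)))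
          (dec-false (v ∈? ⊥) ∉⊥) (conn-⁅⁆ v))
        (lem (χ ⊥) (c + + 2 * + ∣ ⊥ {n} ∣) (ι v ⁅ v ⁆ * (c + + 2 * + ∣ ⁅ v ⁆ ∣))))
        where
        lem : ∀ x c d → (1ℤ - x) * (0ℤ * c) + (1ℤ - 1ℤ) * d ≡ 0ℤ
        lem = solve-∀

      -- The constant 2 comes from the disjoint union. With offset - (k + s + t) the mixed sets
      -- contribute V * (t - (k - 1) * (y - 1)), which is too large for k = 1 but at most 0 for k =
      -- 2, because 1 + t ≤ y. The sets inside T₁ only profit from the larger offset.
      disconnectedAt-∪≤0 : ∀ {κ T₁ T₂ v} → Disjoint T₁ T₂ → Mixed κ T₁ T₂ → v ∈ T₁ →
        disconnectedAt v (- (+ 2 + + ∣ T₁ ∣)) T₁ ≤ 0ℤ →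
        disconnectedAt v (- (+ 2 + + ∣ T₁ ∪ T₂ ∣)) (T₁ ∪ T₂) ≤ 0ℤ
      disconnectedAt-∪≤0 {κ} {T₁} {T₂} {v} d m v∈T₁ D₁≤0 = begin
        disconnectedAt v (- (+ 2 + + ∣ T₁ ∪ T₂ ∣)) (T₁ ∪ T₂)
          ≡⟨ cong (λ x → disconnectedAt v (- (+ 2 + x)) (T₁ ∪ T₂)) (∣∪∣ T₁ T₂ d) ⟩
        disconnectedAt v (- (+ 2 + (s + t))) (T₁ ∪ T₂)
          ≡⟨ disconnectedAt-∪ d m v∈T₁ (- (+ 2 + (s + t))) ⟩
        (1ℤ - 𝟙 κ) * (V * (y * (- (+ 2 + (s + t)) + t + s + 1ℤ) - (- (+ 2 + (s + t)) + s + 1ℤ)))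
          + disconnectedAt v (- (+ 2 + (s + t))) T₁
          ≤⟨ ℤ.+-mono-≤
               (diff⇒≤
                 ((1ℤ - 𝟙 κ) * (V * (y * (- (+ 2 + (s + t)) + t + s + 1ℤ) - (- (+ 2 + (s + t)) + s + 1ℤ))))
                 0ℤ (lem (1ℤ - 𝟙 κ) V y s t)
                 (0≤-* (0≤1-𝟙 κ) (0≤-* (Σ-nonneg T₁ λ S _ → 0≤𝟙 (does (v ∈? S)))
                                       (ℤ.i≤j⇒0≤j-i (1+∣T∣≤2^∣T∣ T₂)))))
               (disconnectedAt-mono v { - (+ 2 + (s + t))} { - (+ 2 + s)} T₁
                 (ℤ.neg-mono-≤ (ℤ.+-monoʳ-≤ (+ 2) (ℤ.i≤i+j s t)))) ⟩
        0ℤ + disconnectedAt v (- (+ 2 + s)) T₁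
          ≤⟨ ℤ.+-monoʳ-≤ 0ℤ D₁≤0 ⟩
        0ℤ ∎
        where
        open ℤ.≤-Reasoning
        s = + ∣ T₁ ∣
        t = + ∣ T₂ ∣
        y = 2^∣ T₂ ∣
        V = Σ⊆ T₁ (ι v)
        lem : ∀ m V y s t →
          0ℤ - m * (V * (y * (- (+ 2 + (s + t)) + t + s + 1ℤ) - (- (+ 2 + (s + t)) + s + 1ℤ)))
          ≡ m * (V * (y - (1ℤ + t)))
        lem = solve-∀

      -- Disconnected subsets of T containing v have average size at most (∣ T ∣ + 2) / 2 ...
      disconnectedAt≤0 : ∀ {T} → Cotree T → ∀ {v} → v ∈ T → disconnectedAt v (- (+ 2 + + ∣ T ∣)) T ≤ 0ℤ
      disconnectedAt≤0 (leaf u) {v} v∈ with refl ← x∈⁅y⁆⇒x≡y u v∈ =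
        ℤ.≤-reflexive (disconnectedAt-⁅⁆ u (- (+ 2 + + ∣ ⁅ u ⁆ ∣)))
      disconnectedAt≤0 (node κ {T₁} {T₂} d m t₁ t₂) {v} v∈ with x∈p∪q⁻ T₁ T₂ v∈
      ... | inj₁ v∈T₁ = disconnectedAt-∪≤0 d m v∈T₁ (disconnectedAt≤0 t₁ v∈T₁)
      ... | inj₂ v∈T₂ = subst (λ T → disconnectedAt v (- (+ 2 + + ∣ T ∣)) T ≤ 0ℤ) (∪-comm T₂ T₁)
        (disconnectedAt-∪≤0 (λ x∈T₂ x∈T₁ → d x∈T₁ x∈T₂) (Mixed-sym m) v∈T₂ (disconnectedAt≤0 t₂ v∈T₂))

      -- T₂ has t ≥ 1 vertices and contributes no disconnected set containing v, so 2 + s ≤ 1 + (s +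
      -- t) makes up for the smaller constant.
      disconnectedAt-join≤0 : ∀ {T₁ T₂ v} → Disjoint T₁ T₂ → Mixed true T₁ T₂ → v ∈ T₁ → Nonempty T₂ →
        disconnectedAt v (- (+ 2 + + ∣ T₁ ∣)) T₁ ≤ 0ℤ →
        disconnectedAt v (- (1ℤ + + ∣ T₁ ∪ T₂ ∣)) (T₁ ∪ T₂) ≤ 0ℤ
      disconnectedAt-join≤0 {T₁} {T₂} {v} d m v∈T₁ (w , w∈T₂) D₁≤0 = begin
        disconnectedAt v (- (1ℤ + + ∣ T₁ ∪ T₂ ∣)) (T₁ ∪ T₂)
          ≡⟨ cong (λ x → disconnectedAt v (- (1ℤ + x)) (T₁ ∪ T₂)) (∣∪∣ T₁ T₂ d) ⟩
        disconnectedAt v (- (1ℤ + (s + t))) (T₁ ∪ T₂)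
          ≡⟨ disconnectedAt-∪ d m v∈T₁ (- (1ℤ + (s + t))) ⟩
        0ℤ * Z + disconnectedAt v (- (1ℤ + (s + t))) T₁
          ≡⟨ cong (_+ disconnectedAt v (- (1ℤ + (s + t))) T₁) (ℤ.*-zeroˡ Z) ⟩
        0ℤ + disconnectedAt v (- (1ℤ + (s + t))) T₁
          ≡⟨ ℤ.+-identityˡ (disconnectedAt v (- (1ℤ + (s + t))) T₁) ⟩
        disconnectedAt v (- (1ℤ + (s + t))) T₁
          ≤⟨ disconnectedAt-mono v { - (1ℤ + (s + t))} { - (+ 2 + s)} T₁
               (ℤ.neg-mono-≤ (diff⇒≤ (+ 2 + s) (1ℤ + (s + t)) (lem s t) (ℤ.i≤j⇒0≤j-i 1≤t))) ⟩
        disconnectedAt v (- (+ 2 + s)) T₁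
          ≤⟨ D₁≤0 ⟩
        0ℤ ∎
        where
        open ℤ.≤-Reasoning
        s = + ∣ T₁ ∣
        t = + ∣ T₂ ∣
        Z = Σ⊆ T₁ (ι v) * (2^∣ T₂ ∣ * (- (1ℤ + (s + t)) + t + s + 1ℤ) - (- (1ℤ + (s + t)) + s + 1ℤ))
        1≤t : 1ℤ ≤ t
        1≤t = +≤+ (ℕ.≤-trans (s≤s z≤n) (x∈p⇒∣p-x∣<∣p∣ w∈T₂))
        lem : ∀ s t → 1ℤ + (s + t) - (+ 2 + s) ≡ t - 1ℤ
        lem = solve-∀

      -- ... and at most (∣ T ∣ + 1) / 2 when T itself is connected.
      disconnectedAt-connected≤0 : ∀ {T} → Cotree T → conn T ≡ true → ∀ {v} → v ∈ T →
        disconnectedAt v (- (1ℤ + + ∣ T ∣)) T ≤ 0ℤ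
      disconnectedAt-connected≤0 (leaf u) _ {v} v∈ with refl ← x∈⁅y⁆⇒x≡y u v∈ =
        ℤ.≤-reflexive (disconnectedAt-⁅⁆ u (- (1ℤ + + ∣ ⁅ u ⁆ ∣)))
      disconnectedAt-connected≤0 (node κ {T₁} {T₂} d m t₁ t₂) connT {v} v∈
        -- T₁ ∪ T₂ is itself a mixed set, so its connectedness forces `κ` to be `true`.
        with refl ← trans (sym (m T₁ T₂ (λ x∈ → x∈) (λ x∈ → x∈)
                            (Cotree⇒Nonempty t₁) (Cotree⇒Nonempty t₂))) connT
        with x∈p∪q⁻ T₁ T₂ v∈
      ... | inj₁ v∈T₁ = disconnectedAt-join≤0 d m v∈T₁ (Cotree⇒Nonempty t₂) (disconnectedAt≤0 t₁ v∈T₁)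
      ... | inj₂ v∈T₂ = subst (λ T → disconnectedAt v (- (1ℤ + + ∣ T ∣)) T ≤ 0ℤ) (∪-comm T₂ T₁)
        (disconnectedAt-join≤0 (λ x∈T₂ x∈T₁ → d x∈T₁ x∈T₂) (Mixed-sym m) v∈T₂ (Cotree⇒Nonempty t₁) (disconnectedAt≤0 t₂ v∈T₂))

-- Cotrees of cographs

does⁻ : ∀ {P : Set} (p? : Dec P) → does p? ≡ true → P
does⁻ (yes p) _ = p

∈-tabulate⁺ : ∀ {p : Fin n → Bool} {x} → p x ≡ true → x ∈ tabulate p
∈-tabulate⁺ {p = p} {x} px = lookup⇒[]= x (tabulate p) (trans (lookup∘tabulate p x) px)

∈-tabulate⁻ : ∀ {p : Fin n → Bool} {x} → x ∈ tabulate p → p x ≡ true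
∈-tabulate⁻ {p = p} {x} x∈ = trans (sym (lookup∘tabulate p x)) ([]=⇒lookup x∈)

x∈T-u⇒x≢u : ∀ {T : Subset n} {x u} → x ∈ T ∖ u → x ≢ u
x∈T-u⇒x≢u {T = T} x∈ refl = x∉T-x T x∈
  where
  x∉T-x : ∀ {n} {x : Fin n} (T : Subset n) → x ∉ T ∖ x
  x∉T-x {x = zero}  (_ ∷ T) ()
  x∉T-x {x = suc x} (_ ∷ T) (there x∈) = x∉T-x T x∈

-- Splitting two-coloured complete graphs without P₄

module _ {n : ℕ} (e : Fin n → Fin n → Bool) where

  -- Since P₄ is self-complementary, both colours may play the role of the edges.
  P₄-free : Set
  P₄-free = ∀ c w x y z → e w x ≡ not c → e x y ≡ not c → e y z ≡ not c →
            e w y ≡ c → e x z ≡ c → e w z ≡ c → Absurd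

  -- Colour `true` exhibits T as a join, colour `false` as a disjoint union. Both sides come from
  -- one Boolean function, so that arguments symmetric in the sides can be indexed by a Boolean.
  record Split (T : Subset n) : Set where
    field
      colour   : Bool
      side     : Fin n → Bool
      inhabits : ∀ b → ∃ λ x → x ∈ T × side x ≡ b
      crossing : ∀ {x y} → x ∈ T → y ∈ T → side x ≢ side y → e x y ≡ colour

  module _ (e-sym : ∀ x y → e x y ≡ e y x) where

    split⁺ : ∀ {T} c (A : Fin n → Bool) →
             (∃ λ x → x ∈ T × A x ≡ true) → (∃ λ x → x ∈ T × A x ≡ false) →
             (∀ {x y} → x ∈ T → y ∈ T → A x ≡ true → A y ≡ false → e x y ≡ c) → Split T
    split⁺ {T} c A t f cross = record
      { colour   = c
      ; side     = A
      ; inhabits = λ { true → t ; false → f }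
      ; crossing = crossing
      }
      where
      crossing : ∀ {x y} → x ∈ T → y ∈ T → A x ≢ A y → e x y ≡ c
      crossing {x} {y} x∈T y∈T Ax≢Ay with A x in Ax | A y in Ay
      ... | true  | true  = contradiction refl Ax≢Ay
      ... | true  | false = cross x∈T y∈T Ax Ay
      ... | false | true  = trans (e-sym x y) (cross y∈T x∈T Ay Ax)
      ... | false | false = contradiction refl Ax≢Ay

    -- Cut T into {x ≢ u | A x} and the rest, which contains u.
    split-around : ∀ {T u} c (A : Fin n → Bool) → u ∈ T → (∃ λ x → x ∈ T ∖ u × A x ≡ true) →
      (∀ {x} → x ∈ T ∖ u → A x ≡ true → e u x ≡ c) →
      (∀ {x y} → x ∈ T ∖ u → y ∈ T ∖ u → A x ≡ true → A y ≡ false → e x y ≡ c) → Split T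
    split-around {T} {u} c A u∈T (x₀ , x₀∈ , Ax₀) at-u cross = split⁺ c A′
      (x₀ , p─q⊆p T ⁅ u ⁆ x₀∈ , A′x₀) (u , u∈T , A′u) cross′
      where
      A′ : Fin n → Bool
      A′ x = if does (x ≟ u) then false else A x
      A′u : A′ u ≡ false
      A′u rewrite dec-true (u ≟ u) refl = refl
      A′x₀ : A′ x₀ ≡ true
      A′x₀ rewrite dec-false (x₀ ≟ u) (x∈T-u⇒x≢u x₀∈) = Ax₀
      cross′ : ∀ {x y} → x ∈ T → y ∈ T → A′ x ≡ true → A′ y ≡ false → e x y ≡ c
      cross′ {x} {y} x∈T y∈T A′x A′y with x ≟ u | y ≟ u
      cross′ {x} {y} x∈T y∈T () A′y | yes _ | _
      ... | no x≢u | yes refl = trans (e-sym x u) (at-u (x∈p∧x≢y⇒x∈p-y x∈T x≢u) A′x)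
      ... | no x≢u | no y≢u   = cross (x∈p∧x≢y⇒x∈p-y x∈T x≢u) (x∈p∧x≢y⇒x∈p-y y∈T y≢u) A′x A′y

    module _ (free : P₄-free) where

      -- A side without vertices of the opposite colour towards u can be cut off as it is. If both
      -- sides have such vertices, then P₄-freeness allows cutting off {x | e u x ≡ colour}.
      extend : ∀ {T u} → u ∈ T → (∀ c → ∃ λ x → x ∈ T ∖ u × e u x ≡ c) → Split (T ∖ u) → Split T
      extend {T} {u} u∈T coloured s = choose (opposite? true) (opposite? false)
        where
        open Split s
        T′ = T ∖ u

        Opposite : Bool → Set
        Opposite b = ∃ λ x → x ∈ T′ × side x ≡ b × e u x ≡ not colour

        opposite? : ∀ b → Dec (Opposite b)
        opposite? b = any? λ x → x ∈? T′ ×-dec side x ≟ᵇ b ×-dec e u x ≟ᵇ not colour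

        is : Bool → Bool → Bool
        is b b′ = does (b′ ≟ᵇ b)

        is⁻ : ∀ {b b′} → is b b′ ≡ true → b′ ≡ b
        is⁻ {b} {b′} = does⁻ (b′ ≟ᵇ b)

        is⁻′ : ∀ {b b′} → is b b′ ≡ false → b′ ≢ b
        is⁻′ {b} eq refl rewrite dec-true (b ≟ᵇ b) refl with () ← eq

        along : ∀ b → ¬ Opposite b → Split T
        along b none = split-around colour (is b ∘ side) u∈T
          (let (x , x∈T′ , sx) = inhabits b in x , x∈T′ , dec-true (side x ≟ᵇ b) sx)
          (λ {x} x∈T′ sx → trans (¬-not λ eq → none (x , x∈T′ , is⁻ sx , eq)) (not-involutive colour))
          (λ x∈T′ y∈T′ sx sy → crossing x∈T′ y∈T′ λ eq → is⁻′ sy (trans (sym eq) (is⁻ sx)))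

        choose : Dec (Opposite true) → Dec (Opposite false) → Split T
        choose (no none) _         = along true none
        choose (yes _)   (no none) = along false none
        choose (yes oₜ)  (yes o_f) = split-around colour (is colour ∘ e u) u∈T
          (let (x , x∈T′ , ux) = coloured colour in x , x∈T′ , dec-true (e u x ≟ᵇ colour) ux)
          (λ _ → is⁻)
          (λ {x} {y} x∈T′ y∈T′ ux uy → cross x∈T′ y∈T′ (is⁻ ux) (¬-not (is⁻′ uy)))
          where
          opposite : ∀ b → Opposite b
          opposite true  = oₜ
          opposite false = o_f
          cross : ∀ {x y} → x ∈ T′ → y ∈ T′ → e u x ≡ colour → e u y ≡ not colour → e x y ≡ colour
          cross {x} {y} x∈T′ y∈T′ ux uy with side x ≟ᵇ side y | e x y ≟ᵇ colour
          ... | _        | yes xy = xy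
          ... | no sx≢sy | no _   = crossing x∈T′ y∈T′ sx≢sy
          -- Some z on the other side has the opposite colour towards u. If e x y were opposite too,
          -- then z, u, y, x would form a forbidden path in the opposite colour.
          ... | yes sx≡sy | no xy =
            let (z , z∈T′ , sz , uz) = opposite (not (side x))
                z≁ = λ {t} (t∈T′ : t ∈ T′) (st : side x ≡ side t) →
                       crossing z∈T′ t∈T′ λ eq → not-¬ (sym st) (trans (sym eq) sz)
            in absurd (free colour z u y x
                 (trans (e-sym z u) uz) uy (trans (e-sym y x) (¬-not xy))
                 (z≁ y∈T′ sx≡sy) ux (z≁ x∈T′ refl))

      -- Seinsche's theorem: a P₄-free graph on at least two vertices, or its complement, is
      -- disconnected. If u sees a single colour, u alone forms a side. Otherwise two vertices of
      -- different colours towards u show that T ∖ u still has two vertices, and its split is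
      -- extended to u.
      split : ∀ {T} → Acc _<_ ∣ T ∣ → ∀ {u w} → u ∈ T → w ∈ T → w ≢ u → Split T
      split {T} (acc rs) {u} {w} u∈T w∈T w≢u = choose (coloured? true) (coloured? false)
        where
        w∈T-u = x∈p∧x≢y⇒x∈p-y w∈T w≢u

        Coloured : Bool → Set
        Coloured c = ∃ λ x → x ∈ T ∖ u × e u x ≡ c

        coloured? : ∀ c → Dec (Coloured c)
        coloured? c = any? λ x → x ∈? (T ∖ u) ×-dec e u x ≟ᵇ c

        isolate : ∀ c → ¬ Coloured (not c) → Split T
        isolate c none = split-around c (λ _ → true) u∈T (w , w∈T-u , refl)
          (λ {x} x∈ _ → trans (¬-not λ eq → none (x , x∈ , eq)) (not-involutive c))
          (λ _ _ _ ())

        choose : Dec (Coloured true) → Dec (Coloured false) → Split T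
        choose (no none) _         = isolate false none
        choose (yes _)   (no none) = isolate true none
        choose (yes cₜ@(x , x∈ , ux)) (yes c_f@(y , y∈ , uy)) =
          extend u∈T (λ { true → cₜ ; false → c_f })
            (split (rs (x∈p⇒∣p-x∣<∣p∣ u∈T)) x∈ y∈
              λ { refl → contradiction (trans (sym ux) uy) λ () })

      module _ (conn : Subset n → Bool)
        (conn-∪ : ∀ {S₁ S₂ c} → Nonempty S₁ → Nonempty S₂ → Disjoint S₁ S₂ →
          (∀ {x y} → x ∈ S₁ → y ∈ S₂ → e x y ≡ c) → conn (S₁ ∪ S₂) ≡ c) where

        cotree : ∀ {T} → Acc _<_ ∣ T ∣ → Nonempty T → Cotree conn T
        cotree {T} (acc rs) (u , u∈T) with any? (λ w → w ∈? T ×-dec ¬? (w ≟ u))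
        ... | no none = subst (Cotree conn)
          (⊆-antisym (λ { x∈ → subst (_∈ T) (sym (x∈⁅y⁆⇒x≡y u x∈)) u∈T })
                     (λ {x} x∈T → ⁅u⁆∋ x∈T))
          (leaf u)
          where
          ⁅u⁆∋ : ∀ {x} → x ∈ T → x ∈ ⁅ u ⁆
          ⁅u⁆∋ {x} x∈T with x ≟ u
          ... | yes refl = x∈⁅x⁆ u
          ... | no x≢u   = contradiction (x , x∈T , x≢u) none
        ... | yes (w , w∈T , w≢u) = subst (Cotree conn) T₁∪T₂≡T
          (node colour disjoint
            (λ S₁ S₂ S₁⊆ S₂⊆ ne₁ ne₂ → conn-∪ ne₁ ne₂ (λ x∈ y∈ → disjoint (S₁⊆ x∈) (S₂⊆ y∈))
              λ x∈ y∈ → crossing (T∩ (S₁⊆ x∈)) (T∩ (S₂⊆ y∈)) (separated (S₁⊆ x∈) (S₂⊆ y∈)))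
            (cotree (rs (p⊂q⇒∣p∣<∣q∣ (part⊂ true))) (nonempty true))
            (cotree (rs (p⊂q⇒∣p∣<∣q∣ (part⊂ false))) (nonempty false)))
          where
          open Split (split (acc rs) u∈T w∈T w≢u)
          part : Bool → Subset n
          part b = T ∩ tabulate (λ x → does (side x ≟ᵇ b))
          part⁺ : ∀ {b x} → x ∈ T → side x ≡ b → x ∈ part b
          part⁺ {b} {x} x∈T sx = x∈p∩q⁺ (x∈T , ∈-tabulate⁺ (dec-true (side x ≟ᵇ b) sx))
          T∩ : ∀ {b x} → x ∈ part b → x ∈ T
          T∩ x∈ = proj₁ (x∈p∩q⁻ T _ x∈)
          part⁻ : ∀ {b x} → x ∈ part b → side x ≡ b
          part⁻ {b} {x} x∈ = does⁻ (side x ≟ᵇ b)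
            (∈-tabulate⁻ {p = λ x → does (side x ≟ᵇ b)} (proj₂ (x∈p∩q⁻ T _ x∈)))
          nonempty : ∀ b → Nonempty (part b)
          nonempty b = let (x , x∈T , sx) = inhabits b in x , part⁺ x∈T sx
          separated : ∀ {x y} → x ∈ part true → y ∈ part false → side x ≢ side y
          separated x∈ y∈ eq with () ← trans (sym (part⁻ x∈)) (trans eq (part⁻ y∈))
          disjoint : Disjoint (part true) (part false)
          disjoint x∈ x∈′ = separated x∈ x∈′ refl
          part⊂ : ∀ b → part b ⊂ T
          part⊂ b = T∩ , let (y , y∈T , sy) = inhabits (not b) in
            y , y∈T , λ y∈ → not-¬ (part⁻ y∈) sy
          T₁∪T₂≡T : part true ∪ part false ≡ T
          T₁∪T₂≡T = ⊆-antisym (λ x∈ → [ T∩ , T∩ ]′ (x∈p∪q⁻ (part true) (part false) x∈))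
            λ {x} x∈T → x∈p∪q⁺ (by x∈T (side x) refl)
            where
            by : ∀ {x} → x ∈ T → ∀ b → side x ≡ b → x ∈ part true ⊎ x ∈ part false
            by x∈T true  sx = inj₁ (part⁺ x∈T sx)
            by x∈T false sx = inj₂ (part⁺ x∈T sx)

-- Adjacency and connectedness in a cograph

module _ {n : ℕ} (G : Graph (Fin n)) where
  open Graph G
  open Graph (P 4) using () renaming (_∼_ to _∼₄_; _∼?_ to _∼₄?_)

  adj : Fin n → Fin n → Bool
  adj x y = does (x ∼? y)

  adj-sym : ∀ x y → adj x y ≡ adj y x
  adj-sym x y = does-⇔ (mk⇔ ∼-sym ∼-sym) (x ∼? y) (y ∼? x)

  adj⁻ : ∀ {x y} → adj x y ≡ true → x ∼ y
  adj⁻ {x} {y} = does⁻ (x ∼? y)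

  -- The rows of the adjacency matrix of P 4 are distinct, so f is injective.
  induced-P₄ : (f : Fin 4 → Fin n) → (∀ i j → adj (f i) (f j) ≡ does (i ∼₄? j)) →
               ∃ λ S → induced G S ≅ P 4
  induced-P₄ f same = S , record
    { bijection = mk↔ₛ′ (λ (x , x∈S) → proj₁ (preimage x∈S)) (λ i → f i , image i)
        (λ i → injective (proj₂ (preimage (image i))))
        (λ (x , x∈S) → ∃-≡ (proj₂ (preimage x∈S)))
    ; adjacency = λ (x , x∈S) (y , y∈S) → adjacency (proj₂ (preimage x∈S)) (proj₂ (preimage y∈S))
    }
    where
    S : Subset n
    S = tabulate λ x → does (any? λ i → f i ≟ x)
    image : ∀ i → f i ∈ S
    image i = ∈-tabulate⁺ (dec-true (any? λ j → f j ≟ f i) (i , refl))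
    preimage : ∀ {x} → x ∈ S → ∃ λ i → f i ≡ x
    preimage {x} x∈S = does⁻ (any? λ i → f i ≟ x) (∈-tabulate⁻ {p = λ x → does (any? λ i → f i ≟ x)} x∈S)
    rows : ∀ i j → (∀ k → does (i ∼₄? k) ≡ does (j ∼₄? k)) → i ≡ j
    rows = from-yes (all? λ i → all? λ j →
      all? (λ k → does (i ∼₄? k) ≟ᵇ does (j ∼₄? k)) →-dec i ≟ j)
    injective : ∀ {i j} → f i ≡ f j → i ≡ j
    injective {i} {j} fi≡fj = rows i j λ k →
      trans (sym (same i k)) (trans (cong (λ x → adj x (f k)) fi≡fj) (same j k))
    ∃-≡ : ∀ {p q : ∃ (_∈ S)} → proj₁ p ≡ proj₁ q → p ≡ q
    ∃-≡ {x , p} {_ , q} refl = cong (x ,_) ([]=-irrelevant p q)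
    adjacency : ∀ {i j x y} → f i ≡ x → f j ≡ y → (x ∼ y) ⇔ (i ∼₄ j)
    adjacency {i} {j} refl refl = mk⇔
      (λ p → does⁻ (i ∼₄? j) (trans (sym (same i j)) (dec-true (f i ∼? f j) p)))
      (λ q → adj⁻ (trans (same i j) (dec-true (i ∼₄? j) q)))

  cograph⇒P₄-free : Cograph G → P₄-free adj
  cograph⇒P₄-free cograph = λ where
      false w x y z wx xy yz wy xz wz → path w x y z wx xy yz wy xz wz
      -- The complement of the path w, x, y, z is the path y, w, z, x.
      true  w x y z wx xy yz wy xz wz →
        path y w z x (trans (adj-sym y w) wy) wz (trans (adj-sym z x) xz)
          yz wx (trans (adj-sym y x) xy)
    where
    path : ∀ w x y z → adj w x ≡ true → adj x y ≡ true → adj y z ≡ true →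
           adj w y ≡ false → adj x z ≡ false → adj w z ≡ false → Absurd
    path w x y z wx xy yz wy xz wz = let (S , iso) = induced-P₄ f same in cograph S iso
      where
      f : Fin 4 → Fin n
      f = lookup (w ∷ x ∷ y ∷ z ∷ [])
      loop : ∀ x → adj x x ≡ false
      loop x = dec-false (x ∼? x) (∼-irr refl)
      same : ∀ i j → adj (f i) (f j) ≡ does (i ∼₄? j)
      same 0F 0F = loop w
      same 0F 1F = wx
      same 0F 2F = wy
      same 0F 3F = wz
      same 1F 0F = trans (adj-sym x w) wx
      same 1F 1F = loop x
      same 1F 2F = xy
      same 1F 3F = xz
      same 2F 0F = trans (adj-sym y w) wy
      same 2F 1F = trans (adj-sym y x) xy
      same 2F 2F = loop y
      same 2F 3F = yz
      same 3F 0F = trans (adj-sym z w) wz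
      same 3F 1F = trans (adj-sym z x) xz
      same 3F 2F = trans (adj-sym z y) yz
      same 3F 3F = loop z

  conn : Subset n → Bool
  conn S = does (inducedConnected? G S)

  conn⁺ : ∀ {S} → Connected (induced G S) → conn S ≡ true
  conn⁺ {S} = dec-true (inducedConnected? G S)

  conn-⊥ : conn ⊥ ≡ false
  conn-⊥ = dec-false (inducedConnected? G ⊥) λ { ((x , x∈⊥) , _) → ∉⊥ x∈⊥ }

  conn-⁅⁆ : ∀ v → conn ⁅ v ⁆ ≡ true
  conn-⁅⁆ v = conn⁺ ((v , x∈⁅x⁆ v) , joined)
    where
    joined : ∀ x y → Star (Graph._∼_ (induced G ⁅ v ⁆)) x y
    joined (x , p) (y , q) with refl ← x∈⁅y⁆⇒x≡y v p | refl ← x∈⁅y⁆⇒x≡y v q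
      with refl ← []=-irrelevant p q = ε

  -- If all cross pairs are adjacent, two vertices of the same part are joined through a vertex of
  -- the other part. If none are, a walk that starts in S₁ never leaves it.
  conn-∪ : ∀ {S₁ S₂ c} → Nonempty S₁ → Nonempty S₂ → Disjoint S₁ S₂ →
           (∀ {x y} → x ∈ S₁ → y ∈ S₂ → adj x y ≡ c) → conn (S₁ ∪ S₂) ≡ c
  conn-∪ {S₁} {S₂} {true} (a , a∈) (b , b∈) _ complete =
    conn⁺ ((a , p⊆p∪q S₂ a∈) , λ (x , x∈) (y , y∈) → joined x∈ y∈ (x∈p∪q⁻ S₁ S₂ x∈) (x∈p∪q⁻ S₁ S₂ y∈))
    where
    open Graph (induced G (S₁ ∪ S₂)) using () renaming (_∼_ to _∼ᵢ_)
    a′ b′ : ∃ (_∈ (S₁ ∪ S₂))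
    a′ = a , p⊆p∪q S₂ a∈
    b′ = b , q⊆p∪q S₁ S₂ b∈
    edge : ∀ {x y} → x ∈ S₁ → y ∈ S₂ → x ∼ y
    edge x∈ y∈ = adj⁻ (complete x∈ y∈)
    joined : ∀ {x y} (x∈ : x ∈ S₁ ∪ S₂) (y∈ : y ∈ S₁ ∪ S₂) → x ∈ S₁ ⊎ x ∈ S₂ → y ∈ S₁ ⊎ y ∈ S₂ →
             Star _∼ᵢ_ (x , x∈) (y , y∈)
    joined x∈ y∈ (inj₁ x∈₁) (inj₂ y∈₂) = edge x∈₁ y∈₂ ◅ ε
    joined x∈ y∈ (inj₂ x∈₂) (inj₁ y∈₁) = ∼-sym (edge y∈₁ x∈₂) ◅ ε
    joined x∈ y∈ (inj₁ x∈₁) (inj₁ y∈₁) = _◅_ {j = b′} (edge x∈₁ b∈) (∼-sym (edge y∈₁ b∈) ◅ ε)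
    joined x∈ y∈ (inj₂ x∈₂) (inj₂ y∈₂) = _◅_ {j = a′} (∼-sym (edge a∈ x∈₂)) (edge a∈ y∈₂ ◅ ε)
  conn-∪ {S₁} {S₂} {false} (a , a∈) (b , b∈) d empty =
    dec-false (inducedConnected? G (S₁ ∪ S₂)) λ (_ , joined) →
      d (trapped (joined (a , p⊆p∪q S₂ a∈) (b , q⊆p∪q S₁ S₂ b∈)) a∈) b∈
    where
    trapped : ∀ {x y} → Star (Graph._∼_ (induced G (S₁ ∪ S₂))) x y → proj₁ x ∈ S₁ → proj₁ y ∈ S₁
    trapped ε x∈₁ = x∈₁
    trapped {x} (_◅_ {j = z} x∼z w) x∈₁ with x∈p∪q⁻ S₁ S₂ (proj₂ z)
    ... | inj₁ z∈₁ = trapped w z∈₁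
    ... | inj₂ z∈₂ = contradiction
      (trans (sym (empty x∈₁ z∈₂)) (dec-true (proj₁ x ∼? proj₁ z) x∼z)) λ ()

  cograph⇒cotree : Cograph G → ∀ {T} → Nonempty T → Cotree conn T
  cograph⇒cotree cograph {T} = cotree adj adj-sym (cograph⇒P₄-free cograph) conn conn-∪ (<-wellFounded ∣ T ∣)

-- Generating polynomials at 1

eval-1 : ∀ p → eval p 1 ≡ sum p
eval-1 []      = refl
eval-1 (c ∷ p) = cong (λ x → c ℕ.+ x) (trans (ℕ.*-identityˡ (eval p 1)) (eval-1 p))

zipWith-applyUpTo : ∀ f g m →
  zipWith ℕ._*_ (applyUpTo f m) (applyUpTo g m) ≡ applyUpTo (λ i → f i ℕ.* g i) m
zipWith-applyUpTo f g zero    = refl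
zipWith-applyUpTo f g (suc m) = cong (f 0 ℕ.* g 0 ∷_) (zipWith-applyUpTo (f ∘ suc) (g ∘ suc) m)

eval-deriv-1 : ∀ g m → eval (deriv (0 ∷ applyUpTo g m)) 1 ≡ sum (applyUpTo (λ i → suc i ℕ.* g i) m)
eval-deriv-1 g m = trans (eval-1 (deriv (0 ∷ applyUpTo g m))) (cong sum (trans
  (cong (λ l → zipWith ℕ._*_ (applyUpTo suc l) (applyUpTo g m)) (length-applyUpTo g m))
  (zipWith-applyUpTo suc g m)))

sum-cong : ∀ {f g : ℕ → ℕ} → (∀ i → f i ≡ g i) → ∀ m → sum (applyUpTo f m) ≡ sum (applyUpTo g m)
sum-cong f≡g zero    = refl
sum-cong f≡g (suc m) = cong₂ ℕ._+_ (f≡g 0) (sum-cong (f≡g ∘ suc) m)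

sum-+ : ∀ f g m → sum (applyUpTo (λ i → f i ℕ.+ g i) m) ≡ sum (applyUpTo f m) ℕ.+ sum (applyUpTo g m)
sum-+ f g zero    = refl
sum-+ f g (suc m) = trans (cong (λ x → f 0 ℕ.+ g 0 ℕ.+ x) (sum-+ (f ∘ suc) (g ∘ suc) m))
  (lem (f 0) (g 0) (sum (applyUpTo (f ∘ suc) m)) (sum (applyUpTo (g ∘ suc) m)))
  where
  lem : ∀ a b c d → a ℕ.+ b ℕ.+ (c ℕ.+ d) ≡ a ℕ.+ c ℕ.+ (b ℕ.+ d)
  lem = ℕ-Solver.solve-∀

sum-0 : ∀ {f : ℕ → ℕ} → (∀ i → f i ≡ 0) → ∀ m → sum (applyUpTo f m) ≡ 0
sum-0 f≡0 zero    = refl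
sum-0 f≡0 (suc m) = cong₂ ℕ._+_ (f≡0 0) (sum-0 (f≡0 ∘ suc) m)

bit : Bool → ℕ
bit true  = 1
bit false = 0

sum-δ : ∀ w {k m} → k < m → sum (applyUpTo (λ i → w i ℕ.* bit (k ≡ᵇ i)) m) ≡ w k
sum-δ w {zero}  {suc m} _ = trans
  (cong₂ ℕ._+_ (ℕ.*-identityʳ (w 0)) (sum-0 (λ i → ℕ.*-zeroʳ (w (suc i))) m)) (ℕ.+-identityʳ (w 0))
sum-δ w {suc k} {suc m} (s≤s k<m) = cong₂ ℕ._+_ (ℕ.*-zeroʳ (w 0)) (sum-δ (w ∘ suc) k<m)

length-filter-∷ : ∀ {A : Set} {Q : A → Set} (Q? : Decidable Q) x xs →
                  length (filter Q? (x ∷ xs)) ≡ bit (does (Q? x)) ℕ.+ length (filter Q? xs)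
length-filter-∷ Q? x xs with does (Q? x)
... | true  = refl
... | false = refl

sum-subsets : ∀ n (h : Subset n → ℕ) → + sum (map h (subsets n)) ≡ Σ⊆ ⊤ (λ S → + h S)
sum-subsets zero    h = cong +_ (ℕ.+-identityʳ (h []))
sum-subsets (suc n) h = begin
  + sum (map h (map (outside ∷_) (subsets n) ++ map (inside ∷_) (subsets n)))
    ≡⟨ cong (+_ ∘ sum) (map-++ h (map (outside ∷_) (subsets n)) _) ⟩
  + sum (map h (map (outside ∷_) (subsets n)) ++ map h (map (inside ∷_) (subsets n)))
    ≡⟨ cong +_ (sum-++ (map h (map (outside ∷_) (subsets n))) _) ⟩
  + (sum (map h (map (outside ∷_) (subsets n))) ℕ.+ sum (map h (map (inside ∷_) (subsets n))))
    ≡⟨ cong₂ (λ xs ys → + (sum xs ℕ.+ sum ys)) (map-∘ (subsets n)) (map-∘ (subsets n)) ⟨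
  + sum (map (h ∘ (outside ∷_)) (subsets n)) + + sum (map (h ∘ (inside ∷_)) (subsets n))
    ≡⟨ cong₂ _+_ (sum-subsets n _) (sum-subsets n _) ⟩
  _ ∎
  where open ≡-Reasoning

-- Both Φ and ΦAt are of this form.
module SizePolynomial {n : ℕ} {Q : Subset n → Set} (Q? : Decidable Q)
  (Q⇒Nonempty : ∀ {S} → Q S → Nonempty S) where

  number : ℕ → ℕ
  number k = length (filter (λ S → (∣ S ∣ ℕ.≟ k) ×-dec Q? S) (subsets n))

  polynomial : Poly
  polynomial = 0 ∷ applyUpTo (λ i → number (suc i)) n

  private
    -- The index i stands for size i + 1: the constant weight 1 yields the value at 1, and `suc`
    -- yields the derivative. The value that `pred` assigns to the empty set is masked, since Q
    -- holds only for nonempty sets.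
    weigh : (ℕ → ℕ) → Subset n → ℕ
    weigh w S = w (pred ∣ S ∣) ℕ.* bit (does (Q? S))

    weigh-one : ∀ w S → sum (applyUpTo (λ i → w i ℕ.* bit ((∣ S ∣ ≡ᵇ suc i) ∧ does (Q? S))) n) ≡ weigh w S
    weigh-one w S with ∣ S ∣ in size | Q? S
    ... | zero | yes q = contradiction
      (ℕ.<-≤-trans (s≤s z≤n) (x∈p⇒∣p-x∣<∣p∣ (proj₂ (Q⇒Nonempty q)))) λ lt →
        ℕ.n≮0 (subst (0 <_) size lt)
    ... | zero  | no _  = trans (sum-0 (λ i → ℕ.*-zeroʳ (w i)) n) (sym (ℕ.*-zeroʳ (w 0)))
    ... | suc k | no _  = trans
      (sum-0 (λ i → trans (cong (λ b → w i ℕ.* bit b) (∧-zeroʳ (k ≡ᵇ i))) (ℕ.*-zeroʳ (w i))) n)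
      (sym (ℕ.*-zeroʳ (w k)))
    ... | suc k | yes _ = trans
      (sum-cong (λ i → cong (λ b → w i ℕ.* bit b) (∧-identityʳ (k ≡ᵇ i))) n)
      (trans (sum-δ w (subst (ℕ._≤ n) size (∣p∣≤n S))) (sym (ℕ.*-identityʳ (w k))))

    -- Interchanges the sum over sizes with the sum over subsets; for one subset the sum over sizes
    -- collapses by `weigh-one`.
    double-count : ∀ w (xs : List (Subset n)) →
      sum (applyUpTo (λ i → w i ℕ.* length (filter (λ S → (∣ S ∣ ℕ.≟ suc i) ×-dec Q? S) xs)) n) ≡
      sum (map (weigh w) xs)
    double-count w []       = sum-0 (λ i → ℕ.*-zeroʳ (w i)) n
    double-count w (S ∷ xs) = begin
      sum (applyUpTo (λ i → w i ℕ.* len i (S ∷ xs)) n)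
        ≡⟨ sum-cong (λ i → trans
             (cong (w i ℕ.*_) (length-filter-∷ (λ S → (∣ S ∣ ℕ.≟ suc i) ×-dec Q? S) S xs))
             (ℕ.*-distribˡ-+ (w i) _ (len i xs))) n ⟩
      sum (applyUpTo (λ i → w i ℕ.* bit ((∣ S ∣ ≡ᵇ suc i) ∧ does (Q? S)) ℕ.+ w i ℕ.* len i xs) n)
        ≡⟨ sum-+ _ _ n ⟩
      _ ≡⟨ cong₂ ℕ._+_ (weigh-one w S) (double-count w xs) ⟩
      sum (map (weigh w) (S ∷ xs)) ∎
      where
      open ≡-Reasoning
      len : ℕ → List (Subset n) → ℕ
      len i xs = length (filter (λ S → (∣ S ∣ ℕ.≟ suc i) ×-dec Q? S) xs)

    +bit : ∀ b → + bit b ≡ 𝟙 b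
    +bit true  = refl
    +bit false = refl

  polynomial-1 : + eval polynomial 1 ≡ Σ⊆ ⊤ (λ S → 𝟙 (does (Q? S)))
  polynomial-1 = begin
    + eval polynomial 1
      ≡⟨ cong +_ (eval-1 polynomial) ⟩
    + sum (applyUpTo (λ i → number (suc i)) n)
      ≡⟨ cong +_ (sum-cong (λ i → sym (ℕ.*-identityˡ (number (suc i)))) n) ⟩
    + sum (applyUpTo (λ i → 1 ℕ.* number (suc i)) n)
      ≡⟨ cong +_ (double-count (λ _ → 1) (subsets n)) ⟩
    + sum (map (weigh (λ _ → 1)) (subsets n))
      ≡⟨ sum-subsets n (weigh (λ _ → 1)) ⟩
    Σ⊆ ⊤ (λ S → + weigh (λ _ → 1) S)
      ≡⟨ Σ-cong ⊤ (λ S _ → trans (cong +_ (ℕ.*-identityˡ _)) (+bit (does (Q? S)))) ⟩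
    _ ∎
    where open ≡-Reasoning

  polynomial′-1 : + eval (deriv polynomial) 1 ≡ Σ⊆ ⊤ (λ S → 𝟙 (does (Q? S)) * + ∣ S ∣)
  polynomial′-1 = begin
    + eval (deriv polynomial) 1
      ≡⟨ cong +_ (eval-deriv-1 (λ i → number (suc i)) n) ⟩
    + sum (applyUpTo (λ i → suc i ℕ.* number (suc i)) n)
      ≡⟨ cong +_ (double-count suc (subsets n)) ⟩
    + sum (map (weigh suc) (subsets n))
      ≡⟨ sum-subsets n (weigh suc) ⟩
    Σ⊆ ⊤ (λ S → + weigh suc S)
      ≡⟨ Σ-cong ⊤ (λ S _ → size S) ⟩
    _ ∎
    where
    open ≡-Reasoning
    size : ∀ S → + weigh suc S ≡ 𝟙 (does (Q? S)) * + ∣ S ∣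
    size S with Q? S
    ... | no _  = cong +_ (ℕ.*-zeroʳ (suc (pred ∣ S ∣)))
    ... | yes q = begin
      + (suc (pred ∣ S ∣) ℕ.* 1)  ≡⟨ cong +_ (ℕ.*-identityʳ _) ⟩
      + suc (pred ∣ S ∣)          ≡⟨ cong +_ (ℕ.suc-pred ∣ S ∣ {{ℕ.>-nonZero
                                       (ℕ.≤-<-trans z≤n (x∈p⇒∣p-x∣<∣p∣ (proj₂ (Q⇒Nonempty q))))}}) ⟩
      + ∣ S ∣                     ≡⟨ ℤ.*-identityˡ (+ ∣ S ∣) ⟨
      1ℤ * + ∣ S ∣                ∎

Σ-avoiding : ∀ {n} (T : Subset n) v f → Σ⊆ T (λ S → (1ℤ - ι v S) * f S) ≡ Σ⊆ (T ∖ v) f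
Σ-avoiding (outside ∷ T) zero f = trans
  (Σ-cong T λ S _ → ℤ.*-identityˡ (f (outside ∷ S)))
  (cong (λ T′ → Σ⊆ T′ (f ∘ (outside ∷_))) (sym (p─⊥≡p T)))
Σ-avoiding (inside  ∷ T) zero f = trans
  (cong₂ _+_ (Σ-cong T λ S _ → ℤ.*-identityˡ (f (outside ∷ S)))
    (trans (Σ-cong T λ S _ → ℤ.*-zeroˡ (f (inside ∷ S))) (Σ-0 T)))
  (trans (ℤ.+-identityʳ (Σ⊆ T (f ∘ (outside ∷_))))
    (cong (λ T′ → Σ⊆ T′ (f ∘ (outside ∷_))) (sym (p─⊥≡p T))))
Σ-avoiding (outside ∷ T) (suc v) f = Σ-avoiding T v _
Σ-avoiding (inside  ∷ T) (suc v) f = cong₂ _+_ (Σ-avoiding T v _) (Σ-avoiding T v _)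

-- Comparison of the means

/-mono-< : ∀ p q r s .{{_ : NonZero q}} .{{_ : NonZero s}} →
           + p * + s ℤ.< + r * + q → (+ p / q) ℚ.< (+ r / s)
/-mono-< p (suc q) r (suc s) ps<rq = ℚ.toℚᵘ-cancel-< (begin-strict
  ℚ.toℚᵘ (+ p / suc q)  ≃⟨ ℚ.toℚᵘ-fromℚᵘ (mkℚᵘ (+ p) q) ⟩
  mkℚᵘ (+ p) q          <⟨ *<* ps<rq ⟩
  mkℚᵘ (+ r) s          ≃⟨ ℚ.toℚᵘ-fromℚᵘ (mkℚᵘ (+ r) s) ⟨
  ℚ.toℚᵘ (+ r / suc s)  ∎)
  where open ℚᵘ.≤-Reasoning

-- The global mean is the mediant (a + a′) / (b + b′) of the means a / b and a′ / b′ of the sets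
-- containing and avoiding v. The first exceeds the second by at least 1/2, so the mediant lies
-- strictly below it.
means-gap : ∀ {n t a b a′ b′} →
  (1ℤ + n) * b ≤ + 2 * a → + 2 * a′ ≤ (1ℤ + t) * b′ → 1ℤ + t ≤ n →
  1ℤ ≤ b → 1ℤ ≤ b′ → (a + a′) * b ℤ.< a * (b + b′)
means-gap {n} {t} {a} {b} {a′} {b′} lower upper t<n 1≤b 1≤b′ = ℤ.≰⇒> λ ≥ →
  contradiction
    -- Cross-multiplying the bounds gives 2 * (a * b′ - a′ * b) ≥ b * b′ ≥ 1. Together with the
    -- negated claim this yields nonnegative terms whose sum is - 1; the part built from b - 1 and
    -- b′ - 1 equals b * b′ - 1.
    (subst (0ℤ ≤_) (lem n t a b a′ b′)
      (0≤-+ (0≤-+ (0≤-+ (0≤-* (ℤ.i≤j⇒0≤j-i lower) 0≤b′) (0≤-* (ℤ.i≤j⇒0≤j-i upper) 0≤b))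
                  (0≤-* (ℤ.i≤j⇒0≤j-i t<n) (0≤-* 0≤b 0≤b′)))
            (0≤-+ (0≤-+ (0≤-* (ℤ.i≤j⇒0≤j-i 1≤b) (ℤ.i≤j⇒0≤j-i 1≤b′))
                        (0≤-+ (ℤ.i≤j⇒0≤j-i 1≤b) (ℤ.i≤j⇒0≤j-i 1≤b′)))
                  (0≤-* {+ 2} 0≤+ (ℤ.i≤j⇒0≤j-i ≥)))))
    λ ()
  where
  0≤b : 0ℤ ≤ b
  0≤b = ℤ.≤-trans 0≤+ 1≤b
  0≤b′ : 0ℤ ≤ b′
  0≤b′ = ℤ.≤-trans 0≤+ 1≤b′
  lem : ∀ n t a b a′ b′ →
    (+ 2 * a - (1ℤ + n) * b) * b′ + ((1ℤ + t) * b′ - + 2 * a′) * b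
      + (n - (1ℤ + t)) * (b * b′)
      + ((b - 1ℤ) * (b′ - 1ℤ) + ((b - 1ℤ) + (b′ - 1ℤ))
        + + 2 * ((a + a′) * b - a * (b + b′)))
    ≡ - 1ℤ
  lem = solve-∀

module _ {n : ℕ} (G : Graph (Fin n)) (v : Fin n) where
  open Graph G

  private
    T = ⊤ ∖ v
    C = conn G

  𝟙-∧ : ∀ b c → 𝟙 (b ∧ c) ≡ 𝟙 c * 𝟙 b
  𝟙-∧ true  true  = refl
  𝟙-∧ true  false = refl
  𝟙-∧ false true  = refl
  𝟙-∧ false false = refl

  conn-⊤ : Connected G → C ⊤ ≡ true
  conn-⊤ (x , walk) = conn⁺ G ((x , ∈⊤) , λ (y , y∈) (z , z∈) →
    subst₂ (λ p q → Star (Graph._∼_ (induced G ⊤)) (y , p) (z , q))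
      ([]=-irrelevant ∈⊤ y∈) ([]=-irrelevant ∈⊤ z∈)
      (gmap (λ x → x , ∈⊤) (λ e → e) (walk y z)))

  Σ-split-at : ∀ f → Σ⊆ ⊤ f ≡ Σ⊆ ⊤ (λ S → ι v S * f S) + Σ⊆ T f
  Σ-split-at f = begin
    Σ⊆ ⊤ f
      ≡⟨ Σ-cong ⊤ (λ S _ → lem (ι v S) (f S)) ⟩
    Σ⊆ ⊤ (λ S → ι v S * f S + (1ℤ - ι v S) * f S)
      ≡⟨ Σ-+ ⊤ (λ S → ι v S * f S) (λ S → (1ℤ - ι v S) * f S) ⟩
    _ ≡⟨ cong (λ x → Σ⊆ ⊤ (λ S → ι v S * f S) + x) (Σ-avoiding ⊤ v f) ⟩
    _ ∎
    where
    open ≡-Reasoning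
    lem : ∀ i x → x ≡ i * x + (1ℤ - i) * x
    lem = solve-∀

  number at-number total at-total : ℕ
  number    = eval (Φ G) 1
  at-number = eval (ΦAt G v) 1
  total     = eval (deriv (Φ G)) 1
  at-total  = eval (deriv (ΦAt G v)) 1

  private
    connectedAt? : Decidable λ S → Connected (induced G S) × v ∈ S
    connectedAt? S = inducedConnected? G S ×-dec (v ∈? S)

    χ′ size : Subset n → ℤ
    χ′ = χ C
    size S = χ′ S * + ∣ S ∣

    module All = SizePolynomial (inducedConnected? G) proj₁
    module At  = SizePolynomial connectedAt? (proj₁ ∘ proj₁)

    NAt WAt : ℤ
    NAt = Σ⊆ ⊤ λ S → ι v S * χ′ S
    WAt = Σ⊆ ⊤ λ S → ι v S * size S

  at-number≡ : + at-number ≡ NAt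
  at-number≡ = trans At.polynomial-1 (Σ-cong ⊤ λ S _ → 𝟙-∧ (C S) (does (v ∈? S)))

  at-total≡ : + at-total ≡ WAt
  at-total≡ = trans At.polynomial′-1 (Σ-cong ⊤ λ S _ → trans
    (cong (_* + ∣ S ∣) (𝟙-∧ (C S) (does (v ∈? S)))) (ℤ.*-assoc (ι v S) (χ′ S) (+ ∣ S ∣)))

  number≡ : + number ≡ NAt + connectedCount C T
  number≡ = trans All.polynomial-1 (Σ-split-at χ′)

  total≡ : + total ≡ WAt + Σ⊆ T size
  total≡ = trans All.polynomial′-1 (Σ-split-at size)

  at-mean-bound : Connected G → Cograph G → (1ℤ + + n) * NAt ≤ + 2 * WAt
  at-mean-bound connected cograph = subst (λ m → (1ℤ + + m) * NAt ≤ + 2 * WAt) (∣⊤∣≡n n)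
    (ℤ.i-j≤0⇒i≤j (subst (_≤ 0ℤ) (disconnectedAt≡ C {⊤} {v} ∈⊤)
      (disconnectedAt-connected≤0 C (conn-⊥ G) (conn-⁅⁆ G)
        (cograph⇒cotree G cograph (v , ∈⊤)) (conn-⊤ connected) {v} ∈⊤)))

  avoiding-mean-bound : Cograph G → Nonempty T → + 2 * Σ⊆ T size ≤ (1ℤ + + ∣ T ∣) * connectedCount C T
  avoiding-mean-bound cograph ne = ℤ.i-j≤0⇒i≤j
    (subst (_≤ 0ℤ) (connectedSum≡ C (1ℤ + + ∣ T ∣) T)
      (connectedSum≤0 C (conn-⊥ G) (conn-⁅⁆ G) (cograph⇒cotree G cograph ne)))

  globalMean<localMean : .{{_ : NonZero n}} → Connected G → Cograph G → Nonempty T →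
                         globalMean G ℚ.< localMean G v
  globalMean<localMean connected cograph ne = /-mono-< total number at-total at-number
    {{Φ-nonZero G}} {{ΦAt-nonZero G v}}
    (transport total≡ at-number≡ at-total≡ number≡
      (means-gap {+ n} {+ ∣ T ∣} {WAt} {NAt} {Σ⊆ T size} {connectedCount C T}
        (at-mean-bound connected cograph) (avoiding-mean-bound cograph ne)
        (+≤+ (subst (suc ∣ T ∣ ℕ.≤_) (∣⊤∣≡n n) (x∈p⇒∣p-x∣<∣p∣ {x = v} ∈⊤)))
        (subst (1ℤ ≤_) at-number≡ (+≤+ (ℕ.>-nonZero⁻¹ at-number {{ΦAt-nonZero G v}})))
        (ℤ.≤-trans (+≤+ (ℕ.≤-trans (s≤s z≤n) (x∈p⇒∣p-x∣<∣p∣ (proj₂ ne))))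
          (∣T∣≤connectedCount C (conn-⊥ G) (conn-⁅⁆ G) (cograph⇒cotree G cograph ne)))))
    where
    transport : ∀ {i i′ j j′ k k′ l l′} → i ≡ i′ → j ≡ j′ → k ≡ k′ → l ≡ l′ →
                i′ * j′ ℤ.< k′ * l′ → i * j ℤ.< k * l
    transport refl refl refl refl i<j = i<j

  -- The only set avoiding v is then ⊥, which is not connected, so numerators and denominators
  -- agree.
  localMean≡globalMean : .{{_ : NonZero n}} → Empty T → localMean G v ≡ globalMean G
  localMean≡globalMean empty = ℚ./-cong {{ΦAt-nonZero G v}} {{Φ-nonZero G}}
    (trans at-total≡ (sym (trans total≡ (vanish size (cong (λ b → 𝟙 b * + ∣ ⊥ {n} ∣) (conn-⊥ G))))))
    (ℤ.+-injective (trans at-number≡ (sym (trans number≡ (vanish χ′ (cong 𝟙 (conn-⊥ G)))))))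
    where
    vanish : ∀ f {i} → f ⊥ ≡ 0ℤ → i + Σ⊆ T f ≡ i
    vanish f {i} f⊥≡0 = trans
      (cong (λ x → i + x) (trans (cong (λ T → Σ⊆ T f) (Empty-unique empty)) (trans (Σ-⊥ n f) f⊥≡0)))
      (ℤ.+-identityʳ i)

  Empty⇒≅K₁ : Empty T → G ≅ K 1
  Empty⇒≅K₁ empty = record
    { bijection = mk↔ₛ′ (λ _ → zero) (λ _ → v) (λ { zero → refl }) (λ x → sym (only x))
    ; adjacency = λ x y → mk⇔
        (λ x∼y → contradiction x∼y (∼-irr (trans (only x) (sym (only y)))))
        (λ z≢z → contradiction refl z≢z)
    }
    where
    only : ∀ x → x ≡ v
    only x with x ≟ v
    ... | yes x≡v = x≡v
    ... | no  x≢v = contradiction (x , x∈p∧x≢y⇒x∈p-y ∈⊤ x≢v) empty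

  ≅K₁⇒Empty : G ≅ K 1 → Empty T
  ≅K₁⇒Empty G≅K₁ (x , x∈T) = v∉ (subst (_∈ T) x≡v x∈T)
    where
    open _≅_ G≅K₁
    v∉ : v ∉ T
    v∉ v∈ = x∈T-u⇒x≢u v∈ refl
    x≡v : x ≡ v
    x≡v = trans (sym (strictlyInverseʳ x)) (trans (cong from (Fin1 (to x) (to v))) (strictlyInverseʳ v))
      where
      open Inverse bijection using (strictlyInverseʳ)
      Fin1 : ∀ (i j : Fin 1) → i ≡ j
      Fin1 zero zero = refl

corollary3p2 : (n : ℕ) .{{_ : NonZero n}} (G : Graph (Fin n)) →
    Connected G → Cograph G → (v : Fin n) →
    (localMean G v ≥ globalMean G) × ((localMean G v ≡ globalMean G) ⇔ (G ≅ K 1))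
corollary3p2 n G connected cograph v = by-cases (nonempty? (⊤ ∖ v))
  where
  by-cases : Dec (Nonempty (⊤ ∖ v)) →
    (localMean G v ≥ globalMean G) × ((localMean G v ≡ globalMean G) ⇔ (G ≅ K 1))
  -- With a second vertex present, both sides of the equivalence are false.
  by-cases (yes ne) = ℚ.<⇒≤ strict , mk⇔
    (λ eq → contradiction strict (ℚ.<-irrefl (sym eq)))
    (λ G≅K₁ → contradiction ne (≅K₁⇒Empty G v G≅K₁))
    where
    strict : globalMean G ℚ.< localMean G v
    strict = globalMean<localMean G v connected cograph ne
  by-cases (no empty) = ℚ.≤-reflexive (sym equal) , mk⇔ (λ _ → Empty⇒≅K₁ G v empty) (λ _ → equal)
    where
    equal : localMean G v ≡ globalMean G
    equal = localMean≡globalMean G v empty
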